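{- Let $r\equiv q\equiv 3\pmod 8$ and $s\equiv 7\pmod 8$ be distinct primes with $\left(\frac{q}{r}\right)=\left(\frac{q}{s}\right)=-1=-\left(\frac{s}{r}\right)$. 1) Let $a,b$ be the integers with $\varepsilon_{qrs}=a+b\sqrt{qrs}$. Then exactly one of the three numbers $2q(a-1)$, $r(a-1)$, $s(a-1)$ is a square in $\mathbb{N}$. Moreover: (a) if $2q(a-1)$ is a square, then $\sqrt{\varepsilon_{qrs}}=b_1\sqrt q+b_2\sqrt{rs}$ and $1=-qb_1^2+rsb_2^2$ for some integers $b_1,b_2$ with $b=2b_1b_2$; (b) if $r(a-1)$ is a square, then $\sqrt{2\varepsilon_{qrs}}=b_1\sqrt r+b_2\sqrt{qs}$ and $2=-rb_1^2+qsb_2^2$ for some integers $b_1,b_2$ with $b=b_1b_2$; (c) if $s(a-1)$ is a square, then $\sqrt{2\varepsilon_{qrs}}=b_1\sqrt s+b_2\sqrt{qr}$ and $2=-sb_1^2+qrb_2^2$ for some integers $b_1,b_2$ with $b=b_1b_2$. 2) Let $x,y$ be the integers with $\varepsilon_{2qrs}=x+y\sqrt{2qrs}$. Then $s(x-1)$ is a square in $\mathbb{N}$, and $\sqrt{2\varepsilon_{2qrs}}=y_1\sqrt s+y_2\sqrt{2qr}$ with $2=-sy_1^2+2qry_2^2$ for some integers $y_1,y_2$.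
   Context: For a square-free integer $d>1$, $\varepsilon_d$ denotes the fundamental unit ($>1$) of $\mathbb{Q}(\sqrt d)$. $\left(\frac{\cdot}{\cdot}\right)$ is the Legendre symbol. -}

module Defs where

open import Data.Nat using (ℕ; _+_; _*_; _%_; _≤_)
open import Data.Nat.Divisibility using (_∣_)
open import Data.Product using (_×_; ∃)
open import Data.Sum using (_⊎_)
open import Relation.Nullary using (¬_)
open import Relation.Binary.PropositionalEquality using (_≡_)

-- n is a square in ℕ
IsSquare : ℕ → Set
IsSquare n = ∃ λ k → k * k ≡ n

-- a + b√d is a unit of ℤ[√d] : a² - d b² = ±1
PellUnit : ℕ → ℕ → ℕ → Set
PellUnit d a b = (a * a ≡ d * (b * b) + 1) ⊎ (a * a + 1 ≡ d * (b * b))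

-- a + b√d (a, b ∈ ℕ) is the fundamental unit ε_d > 1 of ℤ[√d].
-- Units > 1 of ℤ[√d] are exactly a + b√d with a, b ≥ 1 and a² - d b² = ±1;
-- the smallest one is the one with smallest a.
-- (For d ≡ 2,3 mod 4, ℤ[√d] is the ring of integers of ℚ(√d).)
IsFundamentalUnit : ℕ → ℕ → ℕ → Set
IsFundamentalUnit d a b =
  1 ≤ a × 1 ≤ b × PellUnit d a b ×
  (∀ a' b' → 1 ≤ a' → 1 ≤ b' → PellUnit d a' b' → a ≤ a')

-- a is a quadratic residue modulo p : x² ≡ a (mod p) for some x
IsQR : ℕ → ℕ → Set
IsQR a p = ∃ λ x → ∃ λ k → (x * x ≡ a + k * p) ⊎ (x * x + k * p ≡ a)

-- Legendre symbol (a / p) = 1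
LegendreOne : ℕ → ℕ → Set
LegendreOne a p = ¬ (p ∣ a) × IsQR a p

-- Legendre symbol (a / p) = -1
LegendreMinusOne : ℕ → ℕ → Set
LegendreMinusOne a p = ¬ (p ∣ a) × ¬ IsQR a p

-- exactly one of three propositions holds
ExactlyOne : Set → Set → Set → Set
ExactlyOne P Q R =
  (P × ¬ Q × ¬ R) ⊎ (¬ P × Q × ¬ R) ⊎ (¬ P × ¬ Q × R)

{-# OPTIONS --safe #-}
-- A unit of norm −1 would make −1 a square modulo r ≡ 3 (mod 4), so ε = a + b √d has a² − d b² = 1.
-- Then (a − 1)(a + 1) is d times a square; after removing powers of 2 it becomes a product x y of
-- coprime factors with y − x = k ∈ {1, 2}, so x = D u² and y = E v² with D E = d. Every distribution
-- of the prime factors of d between D and E but one is impossible: either a prime p ∈ {q, r, s}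
-- divides D (resp. E) although the Legendre symbols modulo p of E (resp. −D) and k differ, these
-- symbols being fixed by the hypotheses, quadratic reciprocity and the second supplementary law; or
-- D = d and E = 1, and then v + u √d is a unit smaller than ε. The remaining distribution gives the
-- square root of ε or 2 ε in the statement.
-- Legendre symbols modulo p ≡ 3 (mod 4) are computed through Euler's criterion x^((p − 1)/2) ≡ ±1
-- and Gauss's lemma; reciprocity follows from Eisenstein's lemma and a count of lattice points.
module Submission where

open import Defs

open import Data.Bool.Base using (Bool; true; false; not; if_then_else_)
open import Data.Empty using (⊥; ⊥-elim)
open import Data.Integer.Base as ℤ using (ℤ; +_; -_; -[1+_]; 0ℤ; 1ℤ; -1ℤ; ∣_∣; _◃_)
open import Data.Sign.Base as Sign using (Sign)
open import Data.Sign.Properties using (s*s≡+)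
import Data.Integer.Properties as ℤ
open import Data.Integer.Divisibility.Signed as ℤ∣ using (divides; ∣ᵤ⇒∣; ∣⇒∣ᵤ)
open import Data.Integer.Tactic.RingSolver using (solve-∀)
open import Data.Nat.Tactic.RingSolver renaming (solve-∀ to ℕ-solve-∀)
open import Data.List.Base using (List; []; _∷_; _++_; map; length)
open import Data.Vec.Base as Vec using (Vec; []; _∷_)
open import Data.List.Properties using (length-map; length-++; map-id)
open import Data.List.Membership.Propositional using (_∈_)
open import Data.List.Membership.Propositional.Properties using (∈-∃++; ∈-++⁻; ∈-++⁺ˡ; ∈-++⁺ʳ; ∈-map⁻)
open import Data.List.Relation.Binary.Subset.Propositional using (_⊆_)
open import Data.List.Relation.Binary.Permutation.Propositional using (_↭_; ↭-refl; ↭-prep; ↭-trans; ↭-sym)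
open import Data.List.Relation.Binary.Permutation.Propositional.Properties using (shift)
open import Data.List.Relation.Unary.All as All using (All; []; _∷_)
open import Data.List.Relation.Unary.Any using (here; there)
open import Data.List.Relation.Unary.AllPairs using ([]; _∷_)
open import Data.List.Relation.Unary.Unique.Propositional using (Unique)
open import Data.Nat.ListAction using (sum; product)
open import Data.Nat.ListAction.Properties using (sum-↭; product-↭; ∈⇒∣product)
import Data.Nat.Properties as ℕ
open import Data.Nat.Base as ℕ using (ℕ; zero; suc; _+_; _*_; _∸_; _%_; _/_; _≤_; _<_; _<ᵇ_; z≤n; s≤s; NonZero)
open import Data.Nat.DivMod using (m≡m%n+[m/n]*n; m%n<n; m<n⇒m%n≡m; m<n*o⇒m/o<n; m/n*n≤m)
open import Data.Nat.Divisibility using (_∣_; divides; ∣m⇒∣m*n; ∣m+n∣m⇒∣n; ∣⇒≤; ∣1⇒≡1; m%n≡0⇒n∣m; n∣m*n; ∣-antisym; ∣-trans; *-pres-∣)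
open import Data.Nat.GCD using (gcd; gcd-greatest; gcd[m,n]∣m; gcd[m,n]∣n; c*gcd[m,n]≡gcd[cm,cn])
open import Data.Nat.Coprimality as Coprime using (Coprime; coprime-divisor)
open import Data.Nat.Induction using (<-wellFounded)
open import Induction.WellFounded using (Acc; acc)
open import Data.Nat.Primality using (Prime; euclidsLemma; ¬prime[1]; prime[2]; prime⇒nonZero; prime⇒nonTrivial; prime⇒irreducible)
open import Data.Product using (_×_; _,_; proj₁; proj₂; ∃; ∃₂; uncurry)
open import Data.Sum as Sum using (_⊎_; inj₁; inj₂; [_,_]′)
open import Function.Base using (_∘_; id)
open import Relation.Binary.Bundles using (Setoid)
open import Relation.Binary.Definitions using (tri<; tri≈; tri>)
import Relation.Binary.Reasoning.Setoid as SetoidReasoning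
open import Relation.Binary.PropositionalEquality
open import Relation.Nullary.Negation using (¬_)
open import Relation.Nullary.Decidable using (Dec; yes; no)

-- Congruences modulo p

module Congruence (p : ℕ) where

  infix 4 _≈_
  record _≈_ (x y : ℤ) : Set where
    constructor congruent
    field p∣x-y : + p ℤ∣.∣ x ℤ.- y
  open _≈_

  private
    via : ∀ {x y z} → z ≡ x ℤ.- y → + p ℤ∣.∣ z → x ≈ y
    via eq = congruent ∘ subst (+ p ℤ∣.∣_) eq

  ≈-reflexive : ∀ {x y} → x ≡ y → x ≈ y
  ≈-reflexive {x} refl = congruent (divides 0ℤ (ℤ.+-inverseʳ x))

  ≈-refl : ∀ {x} → x ≈ x
  ≈-refl = ≈-reflexive refl

  ≈-sym : ∀ {x y} → x ≈ y → y ≈ x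
  ≈-sym {x} {y} = via (lemma x y) ∘ ℤ∣.∣m⇒∣-m ∘ p∣x-y
    where lemma : ∀ x y → ℤ.- (x ℤ.- y) ≡ y ℤ.- x
          lemma = solve-∀

  ≈-trans : ∀ {x y z} → x ≈ y → y ≈ z → x ≈ z
  ≈-trans {x} {y} {z} x≈y y≈z = via (lemma x y z) (ℤ∣.∣m∣n⇒∣m+n (p∣x-y x≈y) (p∣x-y y≈z))
    where lemma : ∀ x y z → (x ℤ.- y) ℤ.+ (y ℤ.- z) ≡ x ℤ.- z
          lemma = solve-∀

  ≈-setoid : Setoid _ _
  ≈-setoid = record
    { Carrier = ℤ ; _≈_ = _≈_
    ; isEquivalence = record { refl = ≈-refl ; sym = ≈-sym ; trans = ≈-trans } }

  module ≈-Reasoning = SetoidReasoning ≈-setoid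

  +-cong : ∀ {x y u v} → x ≈ y → u ≈ v → x ℤ.+ u ≈ y ℤ.+ v
  +-cong {x} {y} {u} {v} x≈y u≈v = via (lemma x y u v) (ℤ∣.∣m∣n⇒∣m+n (p∣x-y x≈y) (p∣x-y u≈v))
    where lemma : ∀ x y u v → (x ℤ.- y) ℤ.+ (u ℤ.- v) ≡ (x ℤ.+ u) ℤ.- (y ℤ.+ v)
          lemma = solve-∀

  *-cong : ∀ {x y u v} → x ≈ y → u ≈ v → x ℤ.* u ≈ y ℤ.* v
  *-cong {x} {y} {u} {v} x≈y u≈v =
    via (lemma x y u v) (ℤ∣.∣m∣n⇒∣m+n (ℤ∣.∣m⇒∣m*n u (p∣x-y x≈y)) (ℤ∣.∣n⇒∣m*n y (p∣x-y u≈v)))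
    where lemma : ∀ x y u v → (x ℤ.- y) ℤ.* u ℤ.+ y ℤ.* (u ℤ.- v) ≡ x ℤ.* u ℤ.- y ℤ.* v
          lemma = solve-∀

  -‿cong : ∀ {x y} → x ≈ y → ℤ.- x ≈ ℤ.- y
  -‿cong {x} {y} = via (lemma x y) ∘ ℤ∣.∣m⇒∣-m ∘ p∣x-y
    where lemma : ∀ x y → ℤ.- (x ℤ.- y) ≡ ℤ.- x ℤ.- ℤ.- y
          lemma = solve-∀

  ^-cong : ∀ {x y} n → x ≈ y → x ℤ.^ n ≈ y ℤ.^ n
  ^-cong zero    x≈y = ≈-refl
  ^-cong (suc n) x≈y = *-cong x≈y (^-cong n x≈y)

  ≈0⇒∣ : ∀ {x} → x ≈ 0ℤ → p ∣ ∣ x ∣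
  ≈0⇒∣ {x} = ∣⇒∣ᵤ ∘ subst (+ p ℤ∣.∣_) (ℤ.+-identityʳ x) ∘ p∣x-y

  ∣∣⇒≈0 : ∀ {x} → p ∣ ∣ x ∣ → x ≈ 0ℤ
  ∣∣⇒≈0 {x} = congruent ∘ subst (+ p ℤ∣.∣_) (sym (ℤ.+-identityʳ x)) ∘ ∣ᵤ⇒∣

  ∣⇒≈0 : ∀ {n} → p ∣ n → + n ≈ 0ℤ
  ∣⇒≈0 {n} = ∣∣⇒≈0 {+ n}

  ≈⇒-≈0 : ∀ {x y} → x ≈ y → x ℤ.- y ≈ 0ℤ
  ≈⇒-≈0 {x} {y} = via (sym (ℤ.+-identityʳ (x ℤ.- y))) ∘ p∣x-y

  -≈0⇒≈ : ∀ {x y} → x ℤ.- y ≈ 0ℤ → x ≈ y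
  -≈0⇒≈ {x} {y} = via (ℤ.+-identityʳ (x ℤ.- y)) ∘ p∣x-y

  ≈⇒differ-by-multiple : ∀ {x n} → + x ≈ + n → ∃ λ k → x ≡ n + k * p ⊎ x + k * p ≡ n
  ≈⇒differ-by-multiple {x} {n} (congruent (divides (+ k) x-n≡cp)) = k , inj₁ (ℤ.+-injective (begin
    + x                  ≡⟨ lemma (+ x) (+ n) ⟩
    + n ℤ.+ (+ x ℤ.- + n) ≡⟨ cong (ℤ._+_ (+ n)) x-n≡cp ⟩
    + n ℤ.+ + k ℤ.* + p   ≡⟨ cong (ℤ._+_ (+ n)) (ℤ.pos-* k p) ⟨
    + n ℤ.+ + (k * p)     ≡⟨ ℤ.pos-+ n (k * p) ⟨
    + (n + k * p)         ∎))
    where open ≡-Reasoning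
          lemma : ∀ x n → x ≡ n ℤ.+ (x ℤ.- n)
          lemma = solve-∀
  ≈⇒differ-by-multiple {x} {n} (congruent (divides -[1+ k ] x-n≡cp)) = suc k , inj₂ (ℤ.+-injective (begin
    + (x + suc k * p)                          ≡⟨ ℤ.pos-+ x (suc k * p) ⟩
    + x ℤ.+ + (suc k * p)                      ≡⟨ cong (ℤ._+_ (+ x)) (ℤ.pos-* (suc k) p) ⟩
    + x ℤ.+ + suc k ℤ.* + p                    ≡⟨ lemma (+ x) (+ n) (+ suc k) (+ p) ⟩
    + n ℤ.+ (+ x ℤ.- + n ℤ.+ + suc k ℤ.* + p)  ≡⟨ cong (λ z → + n ℤ.+ (z ℤ.+ + suc k ℤ.* + p)) x-n≡cp ⟩
    + n ℤ.+ (ℤ.- + suc k ℤ.* + p ℤ.+ + suc k ℤ.* + p) ≡⟨ lemma′ (+ n) (+ suc k) (+ p) ⟩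
    + n                                        ∎))
    where open ≡-Reasoning
          lemma : ∀ x n K P → x ℤ.+ K ℤ.* P ≡ n ℤ.+ (x ℤ.- n ℤ.+ K ℤ.* P)
          lemma = solve-∀
          lemma′ : ∀ n K P → n ℤ.+ (ℤ.- K ℤ.* P ℤ.+ K ℤ.* P) ≡ n
          lemma′ = solve-∀

  differ-by-multiple⇒≈ : ∀ {x n k} → x ≡ n + k * p ⊎ x + k * p ≡ n → + x ≈ + n
  differ-by-multiple⇒≈ {x} {n} {k} (inj₁ refl) = congruent (divides (+ k) (begin
    + (n + k * p) ℤ.- + n      ≡⟨ cong (ℤ._- + n) (trans (ℤ.pos-+ n (k * p)) (cong (ℤ._+_ (+ n)) (ℤ.pos-* k p))) ⟩
    + n ℤ.+ + k ℤ.* + p ℤ.- + n ≡⟨ lemma (+ n) (+ k ℤ.* + p) ⟩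
    + k ℤ.* + p                ∎))
    where open ≡-Reasoning
          lemma : ∀ n kp → n ℤ.+ kp ℤ.- n ≡ kp
          lemma = solve-∀
  differ-by-multiple⇒≈ {x} {n} {k} (inj₂ refl) = congruent (divides (ℤ.- + k) (begin
    + x ℤ.- + (x + k * p)        ≡⟨ cong (λ z → + x ℤ.- z) (trans (ℤ.pos-+ x (k * p)) (cong (ℤ._+_ (+ x)) (ℤ.pos-* k p))) ⟩
    + x ℤ.- (+ x ℤ.+ + k ℤ.* + p) ≡⟨ lemma (+ x) (+ k) (+ p) ⟩
    ℤ.- + k ℤ.* + p              ∎))
    where open ≡-Reasoning
          lemma : ∀ x k p → x ℤ.- (x ℤ.+ k ℤ.* p) ≡ ℤ.- k ℤ.* p
          lemma = solve-∀

m∣n∧n<m⇒n≡0 : ∀ {m n} → m ∣ n → n < m → n ≡ 0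
m∣n∧n<m⇒n≡0 {n = zero}  _   _   = refl
m∣n∧n<m⇒n≡0 {n = suc n} m∣n n<m = ⊥-elim (ℕ.<⇒≱ n<m (∣⇒≤ m∣n))

-- Sums over 1, …, n

unique∧⊆⇒↭ : {A : Set} {xs ys : List A} → Unique xs → xs ⊆ ys → length ys ≡ length xs → xs ↭ ys
unique∧⊆⇒↭ {xs = []}     {[]}    _ _ _ = ↭-refl
unique∧⊆⇒↭ {xs = x ∷ xs} {ys} (x∉xs ∷ xs!) xs⊆ys |ys|≡ with ∈-∃++ (xs⊆ys (here refl))
... | ys₁ , ys₂ , refl = ↭-trans (↭-prep x (unique∧⊆⇒↭ xs! xs⊆ys₁ys₂ |ys₁ys₂|≡)) (↭-sym (shift x ys₁ ys₂))
  where
  xs⊆ys₁ys₂ : xs ⊆ ys₁ ++ ys₂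
  xs⊆ys₁ys₂ {z} z∈xs with ∈-++⁻ ys₁ (xs⊆ys (there z∈xs))
  ... | inj₁ z∈ys₁         = ∈-++⁺ˡ z∈ys₁
  ... | inj₂ (here refl)   = ⊥-elim (All.lookup x∉xs z∈xs refl)
  ... | inj₂ (there z∈ys₂) = ∈-++⁺ʳ ys₁ z∈ys₂
  |ys₁ys₂|≡ : length (ys₁ ++ ys₂) ≡ length xs
  |ys₁ys₂|≡ = ℕ.suc-injective (begin
    suc (length (ys₁ ++ ys₂))        ≡⟨ cong suc (length-++ ys₁) ⟩
    suc (length ys₁ + length ys₂)    ≡⟨ ℕ.+-suc (length ys₁) (length ys₂) ⟨
    length ys₁ + length (x ∷ ys₂)    ≡⟨ length-++ ys₁ ⟨
    length (ys₁ ++ x ∷ ys₂)          ≡⟨ |ys|≡ ⟩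
    suc (length xs)                  ∎)
    where open ≡-Reasoning

-- range n = n ∷ n − 1 ∷ … ∷ 1 ∷ []
range : ℕ → List ℕ
range zero    = []
range (suc n) = suc n ∷ range n

∈-range⁻ : ∀ {n k} → k ∈ range n → 1 ≤ k × k ≤ n
∈-range⁻ {suc n} (here refl)  = s≤s z≤n , ℕ.≤-refl
∈-range⁻ {suc n} (there k∈n) = proj₁ (∈-range⁻ k∈n) , ℕ.m≤n⇒m≤1+n (proj₂ (∈-range⁻ k∈n))

∈-range⁺ : ∀ {n k} → 1 ≤ k → k ≤ n → k ∈ range n
∈-range⁺ {suc n} {k} 1≤k k≤1+n with k ℕ.≟ suc n
... | yes refl = here refl
... | no  k≢   = there (∈-range⁺ 1≤k (ℕ.≤-pred (ℕ.≤∧≢⇒< k≤1+n k≢)))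
∈-range⁺ {zero} (s≤s _) ()

module _ {f : ℕ → ℕ} {n : ℕ}
         (f-into : ∀ k → 1 ≤ k → k ≤ n → 1 ≤ f k × f k ≤ n)
         (f-injective : ∀ i j → 1 ≤ i → i ≤ n → 1 ≤ j → j ≤ n → f i ≡ f j → i ≡ j) where

  map-range-↭ : map f (range n) ↭ range n
  map-range-↭ = unique∧⊆⇒↭ (unique n ℕ.≤-refl) image⊆ (sym (length-map f (range n)))
    where
    unique : ∀ k → k ≤ n → Unique (map f (range k))
    unique zero    _   = []
    unique (suc k) k<n = All.tabulate fresh ∷ unique k (ℕ.<⇒≤ k<n)
      where
      fresh : ∀ {y} → y ∈ map f (range k) → f (suc k) ≢ y
      fresh y∈ eq with ∈-map⁻ f y∈
      ... | j , j∈k , refl with ∈-range⁻ j∈k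
      ... | 1≤j , j≤k = ℕ.1+n≰n (subst (_≤ k) (sym (f-injective (suc k) j (s≤s z≤n) k<n 1≤j (ℕ.≤-trans j≤k (ℕ.<⇒≤ k<n)) eq)) j≤k)
    image⊆ : map f (range n) ⊆ range n
    image⊆ y∈ with ∈-map⁻ f y∈
    ... | k , k∈n , refl = uncurry ∈-range⁺ (uncurry (f-into k) (∈-range⁻ k∈n))

  product-permutes : product (map f (range n)) ≡ product (range n)
  product-permutes = product-↭ map-range-↭

  sum-permutes : sum (map f (range n)) ≡ sum (range n)
  sum-permutes = sum-↭ map-range-↭

∑ : ℕ → (ℕ → ℕ) → ℕ
∑ n f = sum (map f (range n))

∑-cong : ∀ n {f g : ℕ → ℕ} → (∀ k → 1 ≤ k → k ≤ n → f k ≡ g k) → ∑ n f ≡ ∑ n g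
∑-cong zero    f≡g = refl
∑-cong (suc n) f≡g = cong₂ _+_ (f≡g (suc n) (s≤s z≤n) ℕ.≤-refl) (∑-cong n (λ k 1≤k k≤n → f≡g k 1≤k (ℕ.m≤n⇒m≤1+n k≤n)))

∑-+ : ∀ n f g → ∑ n (λ k → f k + g k) ≡ ∑ n f + ∑ n g
∑-+ zero    f g = refl
∑-+ (suc n) f g = trans (cong (_+_ (f (suc n) + g (suc n))) (∑-+ n f g)) (lemma (f (suc n)) (g (suc n)) (∑ n f) (∑ n g))
  where lemma : ∀ a b c d → a + b + (c + d) ≡ a + c + (b + d)
        lemma = ℕ-solve-∀

∑-*ˡ : ∀ n c f → ∑ n (λ k → c * f k) ≡ c * ∑ n f
∑-*ˡ zero    c f = sym (ℕ.*-zeroʳ c)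
∑-*ˡ (suc n) c f = trans (cong (_+_ (c * f (suc n))) (∑-*ˡ n c f)) (sym (ℕ.*-distribˡ-+ c (f (suc n)) (∑ n f)))

∑-*ʳ : ∀ n c f → ∑ n (λ k → f k * c) ≡ ∑ n f * c
∑-*ʳ n c f = trans (∑-cong n (λ k _ _ → ℕ.*-comm (f k) c)) (trans (∑-*ˡ n c f) (ℕ.*-comm c (∑ n f)))

∑-const : ∀ n c → ∑ n (λ _ → c) ≡ n * c
∑-const zero    c = refl
∑-const (suc n) c = cong (_+_ c) (∑-const n c)

∑-comm : ∀ m n (f : ℕ → ℕ → ℕ) → ∑ m (λ i → ∑ n (f i)) ≡ ∑ n (λ j → ∑ m (λ i → f i j))
∑-comm zero    n f = sym (trans (∑-const n 0) (ℕ.*-zeroʳ n))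
∑-comm (suc m) n f = trans (cong (_+_ (∑ n (f (suc m)))) (∑-comm m n f)) (sym (∑-+ n (f (suc m)) (λ j → ∑ m (λ i → f i j))))

⟦_<_⟧ : ℕ → ℕ → ℕ
⟦ x < y ⟧ = if x <ᵇ y then 1 else 0

⟦<⟧≡1 : ∀ {x y} → x < y → ⟦ x < y ⟧ ≡ 1
⟦<⟧≡1 {x} {y} x<y with x <ᵇ y | ℕ.<⇒<ᵇ x<y
... | true | _ = refl

⟦<⟧≡0 : ∀ {x y} → ¬ x < y → ⟦ x < y ⟧ ≡ 0
⟦<⟧≡0 {x} {y} x≮y with x <ᵇ y | ℕ.<ᵇ⇒< x y
... | true  | <ᵇ⇒< = ⊥-elim (x≮y (<ᵇ⇒< _))
... | false | _     = refl

⟦<⟧+⟦>⟧≡1 : ∀ {x y} → x ≢ y → ⟦ x < y ⟧ + ⟦ y < x ⟧ ≡ 1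
⟦<⟧+⟦>⟧≡1 {x} {y} x≢y with ℕ.<-cmp x y
... | tri< x<y _ y≮x = cong₂ _+_ (⟦<⟧≡1 x<y) (⟦<⟧≡0 y≮x)
... | tri≈ _ x≡y _   = ⊥-elim (x≢y x≡y)
... | tri> x≮y _ y<x = cong₂ _+_ (⟦<⟧≡0 x≮y) (⟦<⟧≡1 y<x)

∑-⟦<⟧ : ∀ h n → ∑ n (λ k → ⟦ h < k ⟧) ≡ n ∸ h
∑-⟦<⟧ h zero = sym (ℕ.0∸n≡0 h)
∑-⟦<⟧ h (suc n) with h ℕ.<? suc n
... | yes h<1+n = trans (cong₂ _+_ (⟦<⟧≡1 h<1+n) (∑-⟦<⟧ h n)) (sym (ℕ.+-∸-assoc 1 (ℕ.≤-pred h<1+n)))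
... | no  h≮1+n = trans (cong₂ _+_ (⟦<⟧≡0 h≮1+n) (∑-⟦<⟧ h n))
                        (trans (ℕ.m≤n⇒m∸n≡0 (ℕ.≤-trans (ℕ.n≤1+n n) 1+n≤h)) (sym (ℕ.m≤n⇒m∸n≡0 1+n≤h)))
  where 1+n≤h : suc n ≤ h
        1+n≤h = ℕ.≮⇒≥ h≮1+n

∑-step : ∀ {f : ℕ → ℕ} {L} N → L ≤ N → (∀ j → 1 ≤ j → j ≤ L → f j ≡ 1) → (∀ j → L < j → f j ≡ 0) → ∑ N f ≡ L
∑-step {f} {L} N L≤N ones zeros with ℕ.m≤n⇒m<n∨m≡n L≤N
... | inj₂ refl = trans (∑-cong N ones) (trans (∑-const N 1) (ℕ.*-identityʳ N))
∑-step (suc N) L≤N ones zeros | inj₁ L<1+N = cong₂ _+_ (zeros (suc N) L<1+N) (∑-step N (ℕ.≤-pred L<1+N) ones zeros)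

-- Powers of −1

ι : Sign → ℤ
ι s = s ◃ 1

ι-* : ∀ s t → ι (s Sign.* t) ≡ ι s ℤ.* ι t
ι-* Sign.+ Sign.+ = refl
ι-* Sign.+ Sign.- = refl
ι-* Sign.- Sign.+ = refl
ι-* Sign.- Sign.- = refl

-1^[n+n]≡1 : ∀ n → -1ℤ ℤ.^ (n + n) ≡ 1ℤ
-1^[n+n]≡1 zero    = refl
-1^[n+n]≡1 (suc n) = begin
  -1ℤ ℤ.^ suc (n + suc n)          ≡⟨ cong (λ k → -1ℤ ℤ.^ suc k) (ℕ.+-suc n n) ⟩
  -1ℤ ℤ.* (-1ℤ ℤ.* -1ℤ ℤ.^ (n + n)) ≡⟨ ℤ.*-assoc -1ℤ -1ℤ _ ⟨
  1ℤ ℤ.* -1ℤ ℤ.^ (n + n)            ≡⟨ ℤ.*-identityˡ _ ⟩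
  -1ℤ ℤ.^ (n + n)                   ≡⟨ -1^[n+n]≡1 n ⟩
  1ℤ                                ∎
  where open ≡-Reasoning

-1^[1+n+n]≡-1 : ∀ n → -1ℤ ℤ.^ suc (n + n) ≡ -1ℤ
-1^[1+n+n]≡-1 n = cong (-1ℤ ℤ.*_) (-1^[n+n]≡1 n)

-1^-sign : ∀ n → ∃ λ s → -1ℤ ℤ.^ n ≡ ι s
-1^-sign zero    = Sign.+ , refl
-1^-sign (suc n) with -1^-sign n
... | Sign.+ , eq = Sign.- , cong (-1ℤ ℤ.*_) eq
... | Sign.- , eq = Sign.+ , cong (-1ℤ ℤ.*_) eq

-1^-+ : ∀ m n → -1ℤ ℤ.^ (m + n) ≡ -1ℤ ℤ.^ m ℤ.* -1ℤ ℤ.^ n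
-1^-+ = ℤ.^-distribˡ-+-* -1ℤ

-1^-parity : ∀ {m n} → -1ℤ ℤ.^ (m + n) ≡ 1ℤ → -1ℤ ℤ.^ m ≡ -1ℤ ℤ.^ n
-1^-parity {m} {n} eq = begin
  -1ℤ ℤ.^ m                                  ≡⟨ ℤ.*-identityʳ _ ⟨
  -1ℤ ℤ.^ m ℤ.* 1ℤ                           ≡⟨ cong (-1ℤ ℤ.^ m ℤ.*_) (trans (sym (-1^[n+n]≡1 n)) (-1^-+ n n)) ⟩
  -1ℤ ℤ.^ m ℤ.* (-1ℤ ℤ.^ n ℤ.* -1ℤ ℤ.^ n)    ≡⟨ ℤ.*-assoc (-1ℤ ℤ.^ m) _ _ ⟨
  -1ℤ ℤ.^ m ℤ.* -1ℤ ℤ.^ n ℤ.* -1ℤ ℤ.^ n      ≡⟨ cong (ℤ._* -1ℤ ℤ.^ n) (trans (sym (-1^-+ m n)) eq) ⟩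
  1ℤ ℤ.* -1ℤ ℤ.^ n                           ≡⟨ ℤ.*-identityˡ _ ⟩
  -1ℤ ℤ.^ n                                  ∎
  where open ≡-Reasoning

-1^-cancel-even : ∀ {a b n} → a + a ≡ b + b + n → -1ℤ ℤ.^ n ≡ 1ℤ
-1^-cancel-even {a} {b} {n} eq = begin
  -1ℤ ℤ.^ n                        ≡⟨ ℤ.*-identityˡ _ ⟨
  1ℤ ℤ.* -1ℤ ℤ.^ n                 ≡⟨ cong (ℤ._* -1ℤ ℤ.^ n) (-1^[n+n]≡1 b) ⟨
  -1ℤ ℤ.^ (b + b) ℤ.* -1ℤ ℤ.^ n    ≡⟨ -1^-+ (b + b) n ⟨
  -1ℤ ℤ.^ (b + b + n)              ≡⟨ cong (-1ℤ ℤ.^_) eq ⟨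
  -1ℤ ℤ.^ (a + a)                  ≡⟨ -1^[n+n]≡1 a ⟩
  1ℤ                               ∎
  where open ≡-Reasoning

^-distribʳ-* : ∀ x y n → (x ℤ.* y) ℤ.^ n ≡ x ℤ.^ n ℤ.* y ℤ.^ n
^-distribʳ-* x y zero    = refl
^-distribʳ-* x y (suc n) = trans (cong (x ℤ.* y ℤ.*_) (^-distribʳ-* x y n)) (lemma x y (x ℤ.^ n) (y ℤ.^ n))
  where lemma : ∀ x y X Y → x ℤ.* y ℤ.* (X ℤ.* Y) ≡ x ℤ.* X ℤ.* (y ℤ.* Y)
        lemma = solve-∀

pos-^ : ∀ n k → + (n ℕ.^ k) ≡ (+ n) ℤ.^ k
pos-^ n zero    = refl
pos-^ n (suc k) = trans (ℤ.pos-* n (n ℕ.^ k)) (cong (+ n ℤ.*_) (pos-^ n k))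

-- Gauss's and Eisenstein's lemmas

module PrimeModulus {p : ℕ} (p-prime : Prime p) where

  open Congruence p public

  ≈0-euclid : ∀ {x y} → x ℤ.* y ≈ 0ℤ → x ≈ 0ℤ ⊎ y ≈ 0ℤ
  ≈0-euclid {x} {y} xy≈0 =
    Sum.map ∣∣⇒≈0 ∣∣⇒≈0 (euclidsLemma ∣ x ∣ ∣ y ∣ p-prime (subst (p ∣_) (ℤ.abs-* x y) (≈0⇒∣ xy≈0)))

  *-cancelʳ-≈ : ∀ {x y n} → ¬ p ∣ n → x ℤ.* + n ≈ y ℤ.* + n → x ≈ y
  *-cancelʳ-≈ {x} {y} {n} p∤n xn≈yn =
    [ -≈0⇒≈ , ⊥-elim ∘ p∤n ∘ ≈0⇒∣ ]′ (≈0-euclid (≈-trans (≈-reflexive (lemma x y (+ n))) (≈⇒-≈0 xn≈yn)))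
    where lemma : ∀ x y n → (x ℤ.- y) ℤ.* n ≡ x ℤ.* n ℤ.- y ℤ.* n
          lemma = solve-∀

  p∤product-range : ∀ n → n < p → ¬ p ∣ product (range n)
  p∤product-range zero    _   p∣1 = ¬prime[1] (subst Prime (∣1⇒≡1 p∣1) p-prime)
  p∤product-range (suc n) n<p p∣ with euclidsLemma (suc n) (product (range n)) p-prime p∣
  ... | inj₁ p∣1+n = ℕ.1+n≢0 (m∣n∧n<m⇒n≡0 p∣1+n n<p)
  ... | inj₂ p∣n!  = p∤product-range n (ℕ.<-trans (ℕ.n<1+n n) n<p) p∣n!

  private
    ≥∧≈⇒≡ : ∀ {i j} → i ≤ j → j < p → + j ≈ + i → j ≡ i
    ≥∧≈⇒≡ {i} {j} i≤j j<p j≈i = ℕ.≤-antisym (ℕ.m∸n≡0⇒m≤n j∸i≡0) i≤j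
      where
      j-i≡j∸i : + j ℤ.- + i ≡ + (j ∸ i)
      j-i≡j∸i = trans (ℤ.m-n≡m⊖n j i) (ℤ.⊖-≥ i≤j)
      j∸i≡0 : j ∸ i ≡ 0
      j∸i≡0 = m∣n∧n<m⇒n≡0 (≈0⇒∣ (subst (_≈ 0ℤ) j-i≡j∸i (≈⇒-≈0 j≈i))) (ℕ.≤-<-trans (ℕ.m∸n≤m j i) j<p)

  ≈⇒≡ : ∀ {i j} → i < p → j < p → + i ≈ + j → i ≡ j
  ≈⇒≡ {i} {j} i<p j<p i≈j with ℕ.≤-total i j
  ... | inj₁ i≤j = sym (≥∧≈⇒≡ i≤j j<p (≈-sym i≈j))
  ... | inj₂ j≤i = ≥∧≈⇒≡ j≤i i<p i≈j

  ≉-neg : ∀ {i j} → 1 ≤ i → i + j < p → ¬ (+ i ≈ ℤ.- + j)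
  ≉-neg {i} {j} 1≤i i+j<p i≈-j = ℕ.<⇒≢ (ℕ.<-≤-trans 1≤i (ℕ.m≤m+n i j)) (sym i+j≡0)
    where
    i+j≈0 : + (i + j) ≈ 0ℤ
    i+j≈0 = begin
      + (i + j)            ≡⟨ ℤ.pos-+ i j ⟩
      + i ℤ.+ + j          ≈⟨ +-cong i≈-j (≈-refl {+ j}) ⟩
      ℤ.- + j ℤ.+ + j      ≡⟨ ℤ.+-inverseˡ (+ j) ⟩
      0ℤ                   ∎
      where open ≈-Reasoning
    i+j≡0 : i + j ≡ 0
    i+j≡0 = m∣n∧n<m⇒n≡0 (≈0⇒∣ i+j≈0) i+j<p

module Gauss {p m : ℕ} (p≡1+2m : p ≡ suc (m + m)) (p-prime : Prime p) {a : ℕ} (p∤a : ¬ p ∣ a) where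

  open PrimeModulus p-prime

  private
    instance
      p≢0 : NonZero p
      p≢0 = prime⇒nonZero p-prime

  m<p : m < p
  m<p = subst (m <_) (sym p≡1+2m) (s≤s (ℕ.m≤m+n m m))

  -- For x < p, ± reflect x is the absolutely least residue of x, negative exactly when m < x.
  reflect : ℕ → ℕ
  reflect x = if m <ᵇ x then p ∸ x else x

  reflect-large : ∀ {x} → m < x → reflect x ≡ p ∸ x
  reflect-large {x} m<x with m <ᵇ x | ℕ.<⇒<ᵇ m<x
  ... | true | _ = refl

  reflect-small : ∀ {x} → ¬ m < x → reflect x ≡ x
  reflect-small {x} m≮x with m <ᵇ x | ℕ.<ᵇ⇒< m x
  ... | true  | <ᵇ⇒< = ⊥-elim (m≮x (<ᵇ⇒< _))
  ... | false | _     = refl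

  reflect-≈ : ∀ {x} → x < p → + x ≈ -1ℤ ℤ.^ ⟦ m < x ⟧ ℤ.* + reflect x
  reflect-≈ {x} x<p with m ℕ.<? x
  ... | yes m<x rewrite ⟦<⟧≡1 m<x | reflect-large m<x =
    congruent (divides 1ℤ (begin
      + x ℤ.- -1ℤ ℤ.* 1ℤ ℤ.* + (p ∸ x)   ≡⟨ lemma (+ x) (+ (p ∸ x)) ⟩
      1ℤ ℤ.* (+ (p ∸ x) ℤ.+ + x)         ≡⟨ cong (1ℤ ℤ.*_) (sym (ℤ.pos-+ (p ∸ x) x)) ⟩
      1ℤ ℤ.* + (p ∸ x + x)               ≡⟨ cong (λ n → 1ℤ ℤ.* + n) (ℕ.m∸n+n≡m (ℕ.<⇒≤ x<p)) ⟩
      1ℤ ℤ.* + p                         ∎))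
    where open ≡-Reasoning
          lemma : ∀ x d → x ℤ.- -1ℤ ℤ.* 1ℤ ℤ.* d ≡ 1ℤ ℤ.* (d ℤ.+ x)
          lemma = solve-∀
  ... | no m≮x rewrite ⟦<⟧≡0 m≮x | reflect-small m≮x = ≈-reflexive (sym (ℤ.*-identityˡ (+ x)))

  reflect-+ : ∀ {x} → x < p → x + 2 * (⟦ m < x ⟧ * reflect x) ≡ reflect x + ⟦ m < x ⟧ * p
  reflect-+ {x} x<p with m ℕ.<? x
  ... | yes m<x rewrite ⟦<⟧≡1 m<x | reflect-large m<x =
    trans (lemma x (p ∸ x)) (cong (λ n → p ∸ x + 1 * n) (ℕ.m∸n+n≡m (ℕ.<⇒≤ x<p)))
    where lemma : ∀ x d → x + 2 * (1 * d) ≡ d + 1 * (d + x)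
          lemma = ℕ-solve-∀
  ... | no m≮x rewrite ⟦<⟧≡0 m≮x | reflect-small m≮x = lemma x p
    where lemma : ∀ x p → x + 2 * (0 * x) ≡ x + 0 * p
          lemma = ℕ-solve-∀

  reflect-range : ∀ {x} → 1 ≤ x → x < p → 1 ≤ reflect x × reflect x ≤ m
  reflect-range {x} 1≤x x<p with m ℕ.<? x
  ... | yes m<x rewrite reflect-large m<x = ℕ.m<n⇒0<n∸m x<p , p∸x≤m
    where p∸x≤m : p ∸ x ≤ m
          p∸x≤m = begin
            p ∸ x          ≤⟨ ℕ.∸-monoʳ-≤ p m<x ⟩
            p ∸ suc m      ≡⟨ cong (_∸ suc m) p≡1+2m ⟩
            suc (m + m) ∸ suc m ≡⟨ ℕ.m+n∸m≡n m m ⟩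
            m              ∎
            where open ℕ.≤-Reasoning
  ... | no m≮x rewrite reflect-small m≮x = 1≤x , ℕ.≮⇒≥ m≮x

  residue : ℕ → ℕ
  residue k = k * a % p

  excess : ℕ → ℕ
  excess k = ⟦ m < residue k ⟧

  fold : ℕ → ℕ
  fold k = reflect (residue k)

  residue-≈ : ∀ k → + (k * a) ≈ + residue k
  residue-≈ k = congruent (divides (+ (k * a / p)) (begin
    + (k * a) ℤ.- + residue k                          ≡⟨ cong (λ n → + n ℤ.- + residue k) (m≡m%n+[m/n]*n (k * a) p) ⟩
    + (residue k + k * a / p * p) ℤ.- + residue k      ≡⟨ cong (ℤ._- + residue k) (ℤ.pos-+ (residue k) _) ⟩
    + residue k ℤ.+ + (k * a / p * p) ℤ.- + residue k  ≡⟨ lemma (+ residue k) _ ⟩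
    + (k * a / p * p)                                  ≡⟨ ℤ.pos-* (k * a / p) p ⟩
    + (k * a / p) ℤ.* + p                              ∎))
    where open ≡-Reasoning
          lemma : ∀ r n → r ℤ.+ n ℤ.- r ≡ n
          lemma = solve-∀

  multiple-≈ : ∀ k → + (k * a) ≈ -1ℤ ℤ.^ excess k ℤ.* + fold k
  multiple-≈ k = ≈-trans (residue-≈ k) (reflect-≈ (m%n<n (k * a) p))

  p∤multiple : ∀ {k} → 1 ≤ k → k < p → ¬ p ∣ k * a
  p∤multiple {k} 1≤k k<p p∣ka with euclidsLemma k a p-prime p∣ka
  ... | inj₁ p∣k = ℕ.<⇒≢ 1≤k (sym (m∣n∧n<m⇒n≡0 p∣k k<p))
  ... | inj₂ p∣a = p∤a p∣a

  fold-range : ∀ k → 1 ≤ k → k ≤ m → 1 ≤ fold k × fold k ≤ m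
  fold-range k 1≤k k≤m = reflect-range 1≤residue (m%n<n (k * a) p)
    where
    1≤residue : 1 ≤ residue k
    1≤residue = ℕ.n≢0⇒n>0 (p∤multiple 1≤k (ℕ.≤-<-trans k≤m m<p) ∘ m%n≡0⇒n∣m (k * a) p)

  private
    same-sign : ∀ {i j} → i < p → j < p → fold i ≡ fold j →
                -1ℤ ℤ.^ excess i ≡ -1ℤ ℤ.^ excess j → i ≡ j
    same-sign {i} {j} i<p j<p fᵢ≡fⱼ εᵢ≡εⱼ = ≈⇒≡ i<p j<p (*-cancelʳ-≈ p∤a (begin
      + i ℤ.* + a                          ≡⟨ ℤ.pos-* i a ⟨
      + (i * a)                            ≈⟨ multiple-≈ i ⟩
      -1ℤ ℤ.^ excess i ℤ.* + fold i        ≡⟨ cong₂ (λ ε f → ε ℤ.* + f) εᵢ≡εⱼ fᵢ≡fⱼ ⟩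
      -1ℤ ℤ.^ excess j ℤ.* + fold j        ≈⟨ ≈-sym (multiple-≈ j) ⟩
      + (j * a)                            ≡⟨ ℤ.pos-* j a ⟩
      + j ℤ.* + a                          ∎))
      where open ≈-Reasoning

    opposite-sign : ∀ {i j} → 1 ≤ i → i ≤ m → j ≤ m → fold i ≡ fold j →
                    -1ℤ ℤ.^ excess i ≡ ℤ.- (-1ℤ ℤ.^ excess j) → ⊥
    opposite-sign {i} {j} 1≤i i≤m j≤m fᵢ≡fⱼ εᵢ≡-εⱼ = ≉-neg 1≤i i+j<p (*-cancelʳ-≈ p∤a (begin
      + i ℤ.* + a                               ≡⟨ ℤ.pos-* i a ⟨
      + (i * a)                                 ≈⟨ multiple-≈ i ⟩
      -1ℤ ℤ.^ excess i ℤ.* + fold i             ≡⟨ cong₂ (λ ε f → ε ℤ.* + f) εᵢ≡-εⱼ fᵢ≡fⱼ ⟩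
      ℤ.- (-1ℤ ℤ.^ excess j) ℤ.* + fold j       ≡⟨ ℤ.neg-distribˡ-* (-1ℤ ℤ.^ excess j) (+ fold j) ⟨
      ℤ.- (-1ℤ ℤ.^ excess j ℤ.* + fold j)       ≈⟨ -‿cong (≈-sym (multiple-≈ j)) ⟩
      ℤ.- + (j * a)                             ≡⟨ cong ℤ.-_ (ℤ.pos-* j a) ⟩
      ℤ.- (+ j ℤ.* + a)                         ≡⟨ ℤ.neg-distribˡ-* (+ j) (+ a) ⟩
      ℤ.- + j ℤ.* + a                           ∎))
      where
      open ≈-Reasoning
      i+j<p : i + j < p
      i+j<p = subst (i + j <_) (sym p≡1+2m) (s≤s (ℕ.+-mono-≤ i≤m j≤m))

  fold-injective : ∀ i j → 1 ≤ i → i ≤ m → 1 ≤ j → j ≤ m → fold i ≡ fold j → i ≡ j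
  fold-injective i j 1≤i i≤m 1≤j j≤m fᵢ≡fⱼ with -1^-sign (excess i) | -1^-sign (excess j)
  ... | Sign.+ , εᵢ | Sign.+ , εⱼ = same-sign (ℕ.≤-<-trans i≤m m<p) (ℕ.≤-<-trans j≤m m<p) fᵢ≡fⱼ (trans εᵢ (sym εⱼ))
  ... | Sign.- , εᵢ | Sign.- , εⱼ = same-sign (ℕ.≤-<-trans i≤m m<p) (ℕ.≤-<-trans j≤m m<p) fᵢ≡fⱼ (trans εᵢ (sym εⱼ))
  ... | Sign.+ , εᵢ | Sign.- , εⱼ = ⊥-elim (opposite-sign 1≤i i≤m j≤m fᵢ≡fⱼ (trans εᵢ (sym (cong ℤ.-_ εⱼ))))
  ... | Sign.- , εᵢ | Sign.+ , εⱼ = ⊥-elim (opposite-sign 1≤i i≤m j≤m fᵢ≡fⱼ (trans εᵢ (sym (cong ℤ.-_ εⱼ))))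

  μ : ℕ
  μ = ∑ m excess

  product-≈ : ∀ n → (+ a) ℤ.^ n ℤ.* + product (range n) ≈
                    -1ℤ ℤ.^ ∑ n excess ℤ.* + product (map fold (range n))
  product-≈ zero    = ≈-refl
  product-≈ (suc n) = begin
    + a ℤ.* A ℤ.* + (suc n * P)                     ≡⟨ cong (+ a ℤ.* A ℤ.*_) (ℤ.pos-* (suc n) P) ⟩
    + a ℤ.* A ℤ.* (+ suc n ℤ.* + P)                 ≡⟨ lemma₁ (+ a) A (+ suc n) (+ P) ⟩
    + suc n ℤ.* + a ℤ.* (A ℤ.* + P)                 ≡⟨ cong (ℤ._* (A ℤ.* + P)) (ℤ.pos-* (suc n) a) ⟨
    + (suc n * a) ℤ.* (A ℤ.* + P)                   ≈⟨ *-cong (multiple-≈ (suc n)) (product-≈ n) ⟩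
    ε ℤ.* + fold (suc n) ℤ.* (E ℤ.* + F)            ≡⟨ lemma₂ ε (+ fold (suc n)) E (+ F) ⟩
    ε ℤ.* E ℤ.* (+ fold (suc n) ℤ.* + F)            ≡⟨ cong₂ ℤ._*_ (-1^-+ (excess (suc n)) (∑ n excess)) (ℤ.pos-* (fold (suc n)) F) ⟨
    -1ℤ ℤ.^ ∑ (suc n) excess ℤ.* + (fold (suc n) * F) ∎
    where
    open ≈-Reasoning
    A ε E : ℤ
    A = (+ a) ℤ.^ n
    ε = -1ℤ ℤ.^ excess (suc n)
    E = -1ℤ ℤ.^ ∑ n excess
    P F : ℕ
    P = product (range n)
    F = product (map fold (range n))
    lemma₁ : ∀ a A k P → a ℤ.* A ℤ.* (k ℤ.* P) ≡ k ℤ.* a ℤ.* (A ℤ.* P)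
    lemma₁ = solve-∀
    lemma₂ : ∀ ε f E F → ε ℤ.* f ℤ.* (E ℤ.* F) ≡ ε ℤ.* E ℤ.* (f ℤ.* F)
    lemma₂ = solve-∀

  gauss : (+ a) ℤ.^ m ≈ -1ℤ ℤ.^ μ
  gauss = *-cancelʳ-≈ (p∤product-range m m<p) (begin
    (+ a) ℤ.^ m ℤ.* + product (range m)              ≈⟨ product-≈ m ⟩
    -1ℤ ℤ.^ μ ℤ.* + product (map fold (range m))     ≡⟨ cong (λ n → -1ℤ ℤ.^ μ ℤ.* + n) (product-permutes fold-range fold-injective) ⟩
    -1ℤ ℤ.^ μ ℤ.* + product (range m)                ∎)
    where open ≈-Reasoning

  quotientSum : ℕ
  quotientSum = ∑ m (λ k → k * a / p)

  multiple-+ : ∀ k → k * a + 2 * (excess k * fold k) ≡ k * a / p * p + fold k + excess k * p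
  multiple-+ k = begin
    k * a + 2 * (excess k * fold k)                 ≡⟨ cong (_+ 2 * (excess k * fold k)) (m≡m%n+[m/n]*n (k * a) p) ⟩
    residue k + q * p + 2 * (excess k * fold k)     ≡⟨ lemma (residue k) (q * p) (2 * (excess k * fold k)) ⟩
    q * p + (residue k + 2 * (excess k * fold k))   ≡⟨ cong (_+_ (q * p)) (reflect-+ (m%n<n (k * a) p)) ⟩
    q * p + (fold k + excess k * p)                 ≡⟨ ℕ.+-assoc (q * p) (fold k) (excess k * p) ⟨
    q * p + fold k + excess k * p                   ∎
    where
    open ≡-Reasoning
    q : ℕ
    q = k * a / p
    lemma : ∀ r n x → r + n + x ≡ n + (r + x)
    lemma = ℕ-solve-∀

  eisenstein-sum : sum (range m) * a + 2 * ∑ m (λ k → excess k * fold k) ≡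
                   quotientSum * p + sum (range m) + μ * p
  eisenstein-sum = begin
    sum (range m) * a + 2 * ∑ m (λ k → excess k * fold k)
      ≡⟨ cong (λ xs → sum xs * a + 2 * ∑ m (λ k → excess k * fold k)) (map-id (range m)) ⟨
    ∑ m (λ k → k) * a + 2 * ∑ m (λ k → excess k * fold k)
      ≡⟨ cong₂ _+_ (∑-*ʳ m a (λ k → k)) (∑-*ˡ m 2 (λ k → excess k * fold k)) ⟨
    ∑ m (λ k → k * a) + ∑ m (λ k → 2 * (excess k * fold k))
      ≡⟨ ∑-+ m _ _ ⟨
    ∑ m (λ k → k * a + 2 * (excess k * fold k))
      ≡⟨ ∑-cong m (λ k _ _ → multiple-+ k) ⟩
    ∑ m (λ k → k * a / p * p + fold k + excess k * p)
      ≡⟨ trans (∑-+ m _ _) (cong (_+ ∑ m (λ k → excess k * p)) (∑-+ m _ _)) ⟩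
    ∑ m (λ k → k * a / p * p) + ∑ m fold + ∑ m (λ k → excess k * p)
      ≡⟨ cong₂ _+_ (cong₂ _+_ (∑-*ʳ m p (λ k → k * a / p)) (sum-permutes fold-range fold-injective)) (∑-*ʳ m p excess) ⟩
    quotientSum * p + sum (range m) + μ * p
      ∎
    where open ≡-Reasoning

  -- For odd a and p, eisenstein-sum taken modulo 2 says that quotientSum + μ is even.
  eisenstein : ∀ {a′} → a ≡ suc (a′ + a′) → (+ a) ℤ.^ m ≈ -1ℤ ℤ.^ quotientSum
  eisenstein {a′} a≡1+2a′ = ≈-trans gauss (≈-reflexive (-1^-parity {μ} (-1^-cancel-even {a′ * S + X} {m * T + m * μ} even)))
    where
    S X T : ℕ
    S = sum (range m)
    X = ∑ m (λ k → excess k * fold k)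
    T = quotientSum
    even : a′ * S + X + (a′ * S + X) ≡ m * T + m * μ + (m * T + m * μ) + (μ + T)
    even = ℕ.+-cancelʳ-≡ S _ _ (begin
      a′ * S + X + (a′ * S + X) + S                    ≡⟨ lemma₁ a′ S X ⟩
      S * suc (a′ + a′) + 2 * X                        ≡⟨ cong (λ n → S * n + 2 * X) a≡1+2a′ ⟨
      S * a + 2 * X                                    ≡⟨ eisenstein-sum ⟩
      T * p + S + μ * p                                ≡⟨ cong (λ n → T * n + S + μ * n) p≡1+2m ⟩
      T * suc (m + m) + S + μ * suc (m + m)            ≡⟨ lemma₂ m T μ S ⟩
      m * T + m * μ + (m * T + m * μ) + (μ + T) + S    ∎)
      where
      open ≡-Reasoning
      lemma₁ : ∀ a′ S X → a′ * S + X + (a′ * S + X) + S ≡ S * suc (a′ + a′) + 2 * X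
      lemma₁ = ℕ-solve-∀
      lemma₂ : ∀ m T μ S → T * suc (m + m) + S + μ * suc (m + m) ≡ m * T + m * μ + (m * T + m * μ) + (μ + T) + S
      lemma₂ = ℕ-solve-∀

-- Parity, coprimality and squares

odd≢even : ∀ m n → suc (m + m) ≢ n + n
odd≢even zero    (suc n) eq = ℕ.1+n≢0 (sym (trans (ℕ.suc-injective eq) (ℕ.+-suc n n)))
odd≢even (suc m) (suc n) eq = odd≢even m n (ℕ.suc-injective (ℕ.suc-injective (trans (sym (cong suc (ℕ.+-suc (suc m) m))) (trans eq (ℕ.+-suc (suc n) n)))))

2∤odd : ∀ {m} → ¬ 2 ∣ suc (m + m)
2∤odd {m} (divides n eq) = odd≢even m n (trans eq (trans (ℕ.*-comm n 2) (cong (_+_ n) (ℕ.+-identityʳ n))))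

parity : ∀ n → ∃ λ c → n ≡ c + c ⊎ n ≡ suc (c + c)
parity zero    = 0 , inj₁ refl
parity (suc n) with parity n
... | c , inj₁ n≡2c   = c , inj₂ (cong suc n≡2c)
... | c , inj₂ n≡1+2c = suc c , inj₁ (trans (cong suc n≡1+2c) (cong suc (sym (ℕ.+-suc c c))))

coprime-suc : ∀ n → Coprime n (suc n)
coprime-suc n {d} (d∣n , d∣1+n) = ∣1⇒≡1 (∣m+n∣m⇒∣n (subst (d ∣_) (ℕ.+-comm 1 n) d∣1+n) d∣n)

coprime-odd-+2 : ∀ n → Coprime (suc (n + n)) (suc (suc (suc (n + n))))
coprime-odd-+2 n {d} (d∣x , d∣x+2) with prime⇒irreducible prime[2] (∣m+n∣m⇒∣n (subst (d ∣_) (ℕ.+-comm 2 (suc (n + n))) d∣x+2) d∣x)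
... | inj₁ d≡1 = d≡1
... | inj₂ refl = ⊥-elim (2∤odd {n} d∣x)

p∣x²⇒p∣x : ∀ {p x} → Prime p → p ∣ x * x → p ∣ x
p∣x²⇒p∣x {x = x} p-prime p∣x² = [ id , id ]′ (euclidsLemma x x p-prime p∣x²)

module _ {p n : ℕ} (p-prime : Prime p) (p∤n : ¬ p ∣ n) where

  private
    instance
      p≢0 : NonZero p
      p≢0 = prime⇒nonZero p-prime

    p∣u : ∀ {u k′} → k′ * p * (k′ * p) ≡ p * n * (u * u) → p ∣ u
    p∣u {u} {k′} eq = p∣x²⇒p∣x p-prime ([ ⊥-elim ∘ p∤n , id ]′ (euclidsLemma n (u * u) p-prime (divides (k′ * k′) nu²≡k′²p)))
      where
      nu²≡k′²p : n * (u * u) ≡ k′ * k′ * p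
      nu²≡k′²p = ℕ.*-cancelˡ-≡ _ _ p (trans (sym (trans eq (ℕ.*-assoc p n (u * u)))) (lemma p k′))
        where lemma : ∀ p k′ → k′ * p * (k′ * p) ≡ p * (k′ * k′ * p)
              lemma = ℕ-solve-∀

    descend : ∀ {u′ k′} → k′ * p * (k′ * p) ≡ p * n * (u′ * p * (u′ * p)) → k′ * k′ ≡ p * n * (u′ * u′)
    descend {u′} {k′} eq = ℕ.*-cancelˡ-≡ _ _ p (ℕ.*-cancelˡ-≡ _ _ p (begin
      p * (p * (k′ * k′))                ≡⟨ lemma₁ p k′ ⟩
      k′ * p * (k′ * p)                  ≡⟨ eq ⟩
      p * n * (u′ * p * (u′ * p))        ≡⟨ lemma₂ p n u′ ⟩
      p * (p * (p * n * (u′ * u′)))      ∎))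
      where
      open ≡-Reasoning
      lemma₁ : ∀ p k′ → p * (p * (k′ * k′)) ≡ k′ * p * (k′ * p)
      lemma₁ = ℕ-solve-∀
      lemma₂ : ∀ p n u′ → p * n * (u′ * p * (u′ * p)) ≡ p * (p * (p * n * (u′ * u′)))
      lemma₂ = ℕ-solve-∀

    descent : ∀ {u k} → Acc _<_ u → 1 ≤ u → k * k ≢ p * n * (u * u)
    descent {u} {k} (acc smaller) 1≤u k²≡pnu² with p∣x²⇒p∣x {x = k} p-prime (divides (n * (u * u)) (trans k²≡pnu² (lemma p n (u * u))))
      where lemma : ∀ p n U → p * n * U ≡ n * U * p
            lemma = ℕ-solve-∀
    ... | divides k′ refl with p∣u {u} {k′} k²≡pnu²
    ... | divides u′ refl = descent {u′} {k′} (smaller (ℕ.m<m*n u′ p (ℕ.nonTrivial⇒n>1 p {{prime⇒nonTrivial p-prime}}))) 1≤u′ (descend {u′} {k′} k²≡pnu²)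
      where
      1≤u′ : 1 ≤ u′
      1≤u′ = ℕ.n≢0⇒n>0 λ { refl → ℕ.<⇒≢ 1≤u refl }
      instance
        u′≢0 : NonZero u′
        u′≢0 = ℕ.>-nonZero 1≤u′

  not-square : ∀ {u k} → 1 ≤ u → k * k ≢ p * n * (u * u)
  not-square {u} {k} = descent {u} {k} (<-wellFounded u)

¬IsSquare : ∀ {p n u x} → Prime p → ¬ p ∣ n → 1 ≤ u → x ≡ p * n * (u * u) → ¬ IsSquare x
¬IsSquare {u = u} p-prime p∤n 1≤u x≡pnu² (k , k²≡x) = not-square p-prime p∤n {u} {k} 1≤u (trans k²≡x x≡pnu²)

square-of : ∀ m u → IsSquare (m * (m * (u * u)))
square-of m u = m * u , lemma m u
  where lemma : ∀ m u → m * u * (m * u) ≡ m * (m * (u * u))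
        lemma = ℕ-solve-∀

half-of-square-factor : ∀ {n b} → ¬ 2 ∣ n → 2 ∣ n * (b * b) → ∃ λ b′ → b ≡ 2 * b′
half-of-square-factor {n} {b} 2∤n 2∣nb² with p∣x²⇒p∣x prime[2] ([ ⊥-elim ∘ 2∤n , id ]′ (euclidsLemma n (b * b) prime[2] 2∣nb²))
... | divides b′ b≡b′2 = b′ , trans b≡b′2 (ℕ.*-comm b′ 2)

square-injective : ∀ {x y} → x * x ≡ y * y → x ≡ y
square-injective {x} {y} eq with ℕ.<-cmp x y
... | tri< x<y _ _ = ⊥-elim (ℕ.<-irrefl eq (ℕ.*-mono-< x<y x<y))
... | tri≈ _ x≡y _ = x≡y
... | tri> _ _ y<x = ⊥-elim (ℕ.<-irrefl (sym eq) (ℕ.*-mono-< y<x y<x))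

1≤c*z²⇒1≤z : ∀ {n c z} → n ≡ c * (z * z) → 1 ≤ n → 1 ≤ z
1≤c*z²⇒1≤z {c = c} n≡cz² 1≤n = ℕ.n≢0⇒n>0 λ { refl → ℕ.<⇒≢ 1≤n (sym (trans n≡cz² (ℕ.*-zeroʳ c))) }

coprime-square : ∀ {x y z} → Coprime x y → x * y ≡ z * z → x ≡ gcd x z * gcd x z
coprime-square {x} {y} {z} coprime xy≡z² = ∣-antisym x∣g² g²∣x
  where
  g : ℕ
  g = gcd x z
  x∣z² : x ∣ z * z
  x∣z² = divides y (trans (sym xy≡z²) (ℕ.*-comm x y))
  x∣gz : x ∣ g * z
  x∣gz = subst (x ∣_) (trans (sym (c*gcd[m,n]≡gcd[cm,cn] z x z)) (ℕ.*-comm z g)) (gcd-greatest (n∣m*n z) x∣z²)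
  x∣g² : x ∣ g * g
  x∣g² = subst (x ∣_) (sym (c*gcd[m,n]≡gcd[cm,cn] g x z)) (gcd-greatest (n∣m*n g) x∣gz)
  g²-coprime-y : Coprime (g * g) y
  g²-coprime-y {d} (d∣g² , d∣y) = coprime (∣-trans d∣g (gcd[m,n]∣m x z) , d∣y)
    where
    d-coprime-g : Coprime d g
    d-coprime-g (e∣d , e∣g) = coprime (∣-trans e∣g (gcd[m,n]∣m x z) , ∣-trans e∣d d∣y)
    d∣g : d ∣ g
    d∣g = coprime-divisor d-coprime-g d∣g²
  g²∣x : g * g ∣ x
  g²∣x = coprime-divisor g²-coprime-y (subst (g * g ∣_) (trans (sym xy≡z²) (ℕ.*-comm x y)) (*-pres-∣ (gcd[m,n]∣n x z) (gcd[m,n]∣n x z)))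

left : (ps : List ℕ) → Vec Bool (length ps) → List ℕ
left []       []           = []
left (p ∷ ps) (true  ∷ bs) = p ∷ left ps bs
left (p ∷ ps) (false ∷ bs) = left ps bs

right : (ps : List ℕ) → Vec Bool (length ps) → List ℕ
right ps bs = left ps (Vec.map not bs)

record SquareClasses (ps : List ℕ) (x y : ℕ) : Set where
  constructor square-classes
  field
    side : Vec Bool (length ps)
    u v  : ℕ
    x≡   : x ≡ product (left ps side) * (u * u)
    y≡   : y ≡ product (right ps side) * (v * v)

split-squares : ∀ ps {x y z} → All Prime ps → Coprime x y → x * y ≡ product ps * (z * z) → SquareClasses ps x y
split-squares [] {x} {y} {z} [] coprime xy≡z² =
  square-classes [] (gcd x z) (gcd y z)
    (trans (coprime-square coprime xy≡z²′) (sym (ℕ.*-identityˡ _)))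
    (trans (coprime-square (Coprime.sym coprime) (trans (ℕ.*-comm y x) xy≡z²′)) (sym (ℕ.*-identityˡ _)))
  where xy≡z²′ : x * y ≡ z * z
        xy≡z²′ = trans xy≡z² (ℕ.*-identityˡ (z * z))
split-squares (p ∷ ps) {x} {y} {z} (p-prime ∷ primes) coprime xy≡ with euclidsLemma x y p-prime (divides (product ps * (z * z)) (trans xy≡ (lemma p (product ps) (z * z))))
  where lemma : ∀ p P Z → p * P * Z ≡ P * Z * p
        lemma = ℕ-solve-∀
... | inj₁ (divides x′ refl) with split-squares ps {x′} {y} {z} primes (λ (d∣x′ , d∣y) → coprime (∣m⇒∣m*n p d∣x′ , d∣y)) x′y≡
  where
  instance
    p≢0 : NonZero p
    p≢0 = prime⇒nonZero p-prime
  x′y≡ : x′ * y ≡ product ps * (z * z)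
  x′y≡ = ℕ.*-cancelˡ-≡ _ _ p (trans (lemma p x′ y) (trans xy≡ (ℕ.*-assoc p (product ps) (z * z))))
    where lemma : ∀ p x′ y → p * (x′ * y) ≡ x′ * p * y
          lemma = ℕ-solve-∀
... | square-classes side u v x′≡ y≡ = square-classes (true ∷ side) u v (trans (cong (_* p) x′≡) (lemma (product (left ps side)) (u * u) p)) y≡
  where lemma : ∀ D U p → D * U * p ≡ p * D * U
        lemma = ℕ-solve-∀
split-squares (p ∷ ps) {x} {y} {z} (p-prime ∷ primes) coprime xy≡ | inj₂ (divides y′ refl) with split-squares ps {x} {y′} {z} primes (λ (d∣x , d∣y′) → coprime (d∣x , ∣m⇒∣m*n p d∣y′)) xy′≡
  where
  instance
    p≢0 : NonZero p
    p≢0 = prime⇒nonZero p-prime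
  xy′≡ : x * y′ ≡ product ps * (z * z)
  xy′≡ = ℕ.*-cancelˡ-≡ _ _ p (trans (lemma p x y′) (trans xy≡ (ℕ.*-assoc p (product ps) (z * z))))
    where lemma : ∀ p x y′ → p * (x * y′) ≡ x * (y′ * p)
          lemma = ℕ-solve-∀
... | square-classes side u v x≡ y′≡ = square-classes (false ∷ side) u v x≡ (trans (cong (_* p) y′≡) (lemma (product (right ps side)) (v * v) p))
  where lemma : ∀ D U p → D * U * p ≡ p * D * U
        lemma = ℕ-solve-∀

-- The quadratic character modulo a prime p ≡ 3 (mod 4)

module QuadraticCharacter {p h : ℕ} (p-prime : Prime p) (p≡4h+3 : p ≡ 4 * h + 3) where

  open PrimeModulus p-prime public

  m : ℕ
  m = suc (h + h)

  p≡1+2m : p ≡ suc (m + m)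
  p≡1+2m = trans p≡4h+3 (lemma h)
    where lemma : ∀ h → 4 * h + 3 ≡ suc (suc (h + h) + suc (h + h))
          lemma = ℕ-solve-∀

  p∤2 : ¬ p ∣ 2
  p∤2 p∣2 = ℕ.<⇒≱ 2<p (∣⇒≤ p∣2)
    where 2<p : 2 < p
          2<p = subst (2 <_) (sym p≡4h+3) (ℕ.m≤n+m 3 (4 * h))

  p∤1 : ¬ p ∣ 1
  p∤1 p∣1 = ¬prime[1] (subst Prime (∣1⇒≡1 p∣1) p-prime)

  χ : ℤ → ℤ
  χ x = x ℤ.^ m

  -- Euler's criterion: for p ∤ x, the Legendre symbol (x/p) is the sign s with χ x ≡ s (mod p).
  record Legendre (x : ℤ) (s : Sign) : Set where
    constructor legendre
    field χ≈ι : χ x ≈ ι s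
  open Legendre public

  Legendre-cong : ∀ {x y s} → x ≈ y → Legendre y s → Legendre x s
  Legendre-cong x≈y (legendre χy≈s) = legendre (≈-trans (^-cong m x≈y) χy≈s)

  Legendre-* : ∀ {x y s t} → Legendre x s → Legendre y t → Legendre (x ℤ.* y) (s Sign.* t)
  Legendre-* {x} {y} {s} {t} (legendre χx) (legendre χy) = legendre (begin
    χ (x ℤ.* y)         ≡⟨ ^-distribʳ-* x y m ⟩
    χ x ℤ.* χ y         ≈⟨ *-cong χx χy ⟩
    ι s ℤ.* ι t         ≡⟨ ι-* s t ⟨
    ι (s Sign.* t)      ∎)
    where open ≈-Reasoning

  infixr 7 _⊛_
  _⊛_ : ∀ {x y s t} → Legendre (+ x) s → Legendre (+ y) t → Legendre (+ (x * y)) (s Sign.* t)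
  _⊛_ {x} {y} χx χy = Legendre-cong (≈-reflexive (ℤ.pos-* x y)) (Legendre-* χx χy)

  Legendre-1 : Legendre 1ℤ Sign.+
  Legendre-1 = legendre (≈-reflexive (ℤ.^-zeroˡ m))

  Legendre-neg : ∀ {x s} → Legendre x s → Legendre (ℤ.- x) (Sign.opposite s)
  Legendre-neg {x} {s} (legendre χx) = legendre (begin
    χ (ℤ.- x)                 ≡⟨ cong χ (ℤ.-1*i≡-i x) ⟨
    χ (-1ℤ ℤ.* x)             ≡⟨ ^-distribʳ-* -1ℤ x m ⟩
    -1ℤ ℤ.^ m ℤ.* χ x         ≡⟨ cong (ℤ._* χ x) (-1^[1+n+n]≡-1 h) ⟩
    -1ℤ ℤ.* χ x               ≈⟨ *-cong (≈-refl { -1ℤ}) χx ⟩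
    -1ℤ ℤ.* ι s               ≡⟨ ι-* Sign.- s ⟨
    ι (Sign.opposite s)       ∎)
    where open ≈-Reasoning

  1≉-1 : ¬ 1ℤ ≈ -1ℤ
  1≉-1 1≈-1 = p∤2 (≈0⇒∣ (≈⇒-≈0 1≈-1))

  symbols-differ : ∀ {x s} → Legendre x s → ¬ Legendre x (Sign.opposite s)
  symbols-differ {s = Sign.+} (legendre χx≈1) (legendre χx≈-1) = 1≉-1 (≈-trans (≈-sym χx≈1) χx≈-1)
  symbols-differ {s = Sign.-} (legendre χx≈-1) (legendre χx≈1) = 1≉-1 (≈-trans (≈-sym χx≈1) χx≈-1)

  Legendre-unique : ∀ {x s t} → Legendre x s → Legendre x t → s ≡ t
  Legendre-unique {s = Sign.+} {Sign.+} _ _ = refl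
  Legendre-unique {s = Sign.-} {Sign.-} _ _ = refl
  Legendre-unique {s = Sign.+} {Sign.-} χx χx′ = ⊥-elim (symbols-differ χx χx′)
  Legendre-unique {s = Sign.-} {Sign.+} χx χx′ = ⊥-elim (symbols-differ χx χx′)

  Legendre-sign : ∀ {n} → ¬ p ∣ n → ∃ (Legendre (+ n))
  Legendre-sign {n} p∤n = proj₁ (-1^-sign G.μ) , legendre (≈-trans G.gauss (≈-reflexive (proj₂ (-1^-sign G.μ))))
    where module G = Gauss {m = m} p≡1+2m p-prime p∤n

  Legendre-square : ∀ {n} → ¬ p ∣ n → Legendre (+ (n * n)) Sign.+
  Legendre-square {n} p∤n = subst (Legendre (+ (n * n))) (s*s≡+ s) (χn ⊛ χn)
    where s : Sign
          s = proj₁ (Legendre-sign p∤n)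
          χn : Legendre (+ n) s
          χn = proj₂ (Legendre-sign p∤n)

  residue⇒Legendre+ : ∀ {n} → LegendreOne n p → Legendre (+ n) Sign.+
  residue⇒Legendre+ {n} (p∤n , x , k , x²∼n) = Legendre-cong (≈-sym x²≈n) (Legendre-square p∤x)
    where
    x²≈n : + (x * x) ≈ + n
    x²≈n = differ-by-multiple⇒≈ {k = k} x²∼n
    p∤x : ¬ p ∣ x
    p∤x p∣x = p∤n (≈0⇒∣ (begin
      + n             ≈⟨ ≈-sym x²≈n ⟩
      + (x * x)       ≡⟨ ℤ.pos-* x x ⟩
      + x ℤ.* + x     ≈⟨ *-cong (∣⇒≈0 p∣x) (≈-refl {+ x}) ⟩
      0ℤ ℤ.* + x      ≡⟨ ℤ.*-zeroˡ (+ x) ⟩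
      0ℤ              ∎))
      where open ≈-Reasoning

  -- m is odd, so y = n ^ ((m + 1) / 2) satisfies y² = n χ(n) ≡ n.
  Legendre+⇒residue : ∀ {n} → Legendre (+ n) Sign.+ → IsQR n p
  Legendre+⇒residue {n} (legendre χn≈1) = y , ≈⇒differ-by-multiple y²≈n
    where
    y : ℕ
    y = n ℕ.^ suc h
    y²≈n : + (y * y) ≈ + n
    y²≈n = begin
      + (y * y)                                  ≡⟨ ℤ.pos-* y y ⟩
      + y ℤ.* + y                                ≡⟨ cong₂ ℤ._*_ (pos-^ n (suc h)) (pos-^ n (suc h)) ⟩
      (+ n) ℤ.^ suc h ℤ.* (+ n) ℤ.^ suc h        ≡⟨ ℤ.^-distribˡ-+-* (+ n) (suc h) (suc h) ⟨
      (+ n) ℤ.^ (suc h + suc h)                  ≡⟨ cong ((+ n) ℤ.^_) (ℕ.+-suc (suc h) h) ⟩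
      + n ℤ.* χ (+ n)                            ≈⟨ *-cong (≈-refl {+ n}) χn≈1 ⟩
      + n ℤ.* 1ℤ                                 ≡⟨ ℤ.*-identityʳ (+ n) ⟩
      + n                                        ∎
      where open ≈-Reasoning

  nonresidue⇒Legendre- : ∀ {n} → LegendreMinusOne n p → Legendre (+ n) Sign.-
  nonresidue⇒Legendre- {n} (p∤n , ¬qr) = from-sign (Legendre-sign p∤n)
    where from-sign : ∃ (Legendre (+ n)) → Legendre (+ n) Sign.-
          from-sign (Sign.+ , χn) = ⊥-elim (¬qr (Legendre+⇒residue χn))
          from-sign (Sign.- , χn) = χn

  private
    instance
      p≢0 : NonZero p
      p≢0 = prime⇒nonZero p-prime

    module Two = Gauss {m = m} p≡1+2m p-prime p∤2

    excess-2 : ∀ k → 1 ≤ k → k ≤ m → Two.excess k ≡ ⟦ h < k ⟧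
    excess-2 k _ k≤m = trans (cong ⟦ m <_⟧ (m<n⇒m%n≡m 2k<p)) (compare (h ℕ.<? k))
      where
      2k<p : k * 2 < p
      2k<p = subst (k * 2 <_) (sym p≡1+2m) (s≤s (subst (k * 2 ≤_) (lemma m) (ℕ.*-monoˡ-≤ 2 k≤m)))
        where lemma : ∀ m → m * 2 ≡ m + m
              lemma = ℕ-solve-∀
      compare : Dec (h < k) → ⟦ m < k * 2 ⟧ ≡ ⟦ h < k ⟧
      compare (yes h<k) = trans (⟦<⟧≡1 m<2k) (sym (⟦<⟧≡1 h<k))
        where m<2k : m < k * 2
              m<2k = subst (_≤ k * 2) (lemma h) (ℕ.*-monoˡ-≤ 2 h<k)
                where lemma : ∀ h → suc h * 2 ≡ suc (suc (h + h))
                      lemma = ℕ-solve-∀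
      compare (no h≮k) = trans (⟦<⟧≡0 (ℕ.≤⇒≯ 2k≤m)) (sym (⟦<⟧≡0 h≮k))
        where 2k≤m : k * 2 ≤ m
              2k≤m = ℕ.≤-trans (ℕ.*-monoˡ-≤ 2 (ℕ.≮⇒≥ h≮k)) (subst (_≤ m) (lemma h) (ℕ.n≤1+n (h + h)))
                where lemma : ∀ h → h + h ≡ h * 2
                      lemma = ℕ-solve-∀

    μ-2 : Two.μ ≡ suc h
    μ-2 = begin
      Two.μ                  ≡⟨ ∑-cong m excess-2 ⟩
      ∑ m (λ k → ⟦ h < k ⟧)  ≡⟨ ∑-⟦<⟧ h m ⟩
      suc (h + h) ∸ h        ≡⟨ ℕ.+-∸-assoc 1 (ℕ.m≤m+n h h) ⟩
      suc (h + h ∸ h)        ≡⟨ cong suc (ℕ.m+n∸m≡n h h) ⟩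
      suc h                  ∎
      where open ≡-Reasoning

  Legendre-2 : χ (+ 2) ≈ -1ℤ ℤ.^ suc h
  Legendre-2 = ≈-trans Two.gauss (≈-reflexive (cong (-1ℤ ℤ.^_) μ-2))

  Legendre-2-h-even : ∀ {t} → h ≡ t + t → Legendre (+ 2) Sign.-
  Legendre-2-h-even {t} h≡2t = legendre (≈-trans Legendre-2 (≈-reflexive (trans (cong (λ n → -1ℤ ℤ.^ suc n) h≡2t) (-1^[1+n+n]≡-1 t))))

  Legendre-2-h-odd : ∀ {t} → h ≡ suc (t + t) → Legendre (+ 2) Sign.+
  Legendre-2-h-odd {t} h≡1+2t = legendre (≈-trans Legendre-2 (≈-reflexive (trans (cong (λ n → -1ℤ ℤ.^ suc n) h≡1+2t) (cong (-1ℤ ℤ.*_) (-1^[1+n+n]≡-1 t)))))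

  Legendre-cofactor : ∀ {x v c t} → x ℤ.* + (v * v) ≈ c → ¬ c ≈ 0ℤ → Legendre c t → Legendre x t
  Legendre-cofactor {x} {v} {c} {t} xv²≈c c≉0 (legendre χc) = legendre (begin
    χ x                                ≡⟨ ℤ.*-identityʳ (χ x) ⟨
    χ x ℤ.* 1ℤ                         ≈⟨ *-cong (≈-refl {χ x}) (≈-sym (χ≈ι (Legendre-square p∤v))) ⟩
    χ x ℤ.* χ (+ (v * v))              ≡⟨ ^-distribʳ-* x (+ (v * v)) m ⟨
    χ (x ℤ.* + (v * v))                ≈⟨ ^-cong m xv²≈c ⟩
    χ c                                ≈⟨ χc ⟩
    ι t                                ∎)
    where
    open ≈-Reasoning
    p∤v : ¬ p ∣ v
    p∤v p∣v = c≉0 (begin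
      c                          ≈⟨ ≈-sym xv²≈c ⟩
      x ℤ.* + (v * v)            ≈⟨ *-cong (≈-refl {x}) (∣⇒≈0 (∣m⇒∣m*n v p∣v)) ⟩
      x ℤ.* 0ℤ                   ≡⟨ ℤ.*-zeroʳ x ⟩
      0ℤ                         ∎)

  split-at-left : ∀ {d e k s} u v → e * (v * v) ≡ k + d * (u * u) → p ∣ d → ¬ p ∣ k →
                  Legendre (+ e) s → Legendre (+ k) (Sign.opposite s) → ⊥
  split-at-left {d} {e} {k} u v eq p∣d p∤k χe χk =
    symbols-differ χe (Legendre-cofactor {v = v} ev²≈k (p∤k ∘ ≈0⇒∣) χk)
    where
    ev²≈k : + e ℤ.* + (v * v) ≈ + k
    ev²≈k = begin
      + e ℤ.* + (v * v)            ≡⟨ ℤ.pos-* e (v * v) ⟨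
      + (e * (v * v))              ≡⟨ cong +_ eq ⟩
      + (k + d * (u * u))          ≡⟨ ℤ.pos-+ k (d * (u * u)) ⟩
      + k ℤ.+ + (d * (u * u))      ≈⟨ +-cong (≈-refl {+ k}) (∣⇒≈0 (∣m⇒∣m*n (u * u) p∣d)) ⟩
      + k ℤ.+ 0ℤ                   ≡⟨ ℤ.+-identityʳ (+ k) ⟩
      + k                          ∎
      where open ≈-Reasoning

  split-at-right : ∀ {d e k s} u v → e * (v * v) ≡ k + d * (u * u) → p ∣ e → ¬ p ∣ k →
                   Legendre (ℤ.- + d) s → Legendre (+ k) (Sign.opposite s) → ⊥
  split-at-right {d} {e} {k} u v eq p∣e p∤k χ-d χk =
    symbols-differ χ-d (Legendre-cofactor {v = u} -du²≈k (p∤k ∘ ≈0⇒∣) χk)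
    where
    p∣k+du² : p ∣ k + d * (u * u)
    p∣k+du² = subst (p ∣_) eq (∣m⇒∣m*n (v * v) p∣e)
    -du²≈k : ℤ.- + d ℤ.* + (u * u) ≈ + k
    -du²≈k = begin
      ℤ.- + d ℤ.* + (u * u)                  ≡⟨ lemma (+ k) (+ d) (+ (u * u)) ⟩
      + k ℤ.- (+ k ℤ.+ + d ℤ.* + (u * u))    ≡⟨ cong (λ z → + k ℤ.- (+ k ℤ.+ z)) (ℤ.pos-* d (u * u)) ⟨
      + k ℤ.- (+ k ℤ.+ + (d * (u * u)))      ≡⟨ cong (λ z → + k ℤ.- z) (ℤ.pos-+ k (d * (u * u))) ⟨
      + k ℤ.- + (k + d * (u * u))            ≈⟨ +-cong (≈-refl {+ k}) (-‿cong (∣⇒≈0 p∣k+du²)) ⟩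
      + k ℤ.- 0ℤ                             ≡⟨ ℤ.+-identityʳ (+ k) ⟩
      + k                                    ∎
      where open ≈-Reasoning
            lemma : ∀ k d U → ℤ.- d ℤ.* U ≡ k ℤ.- (k ℤ.+ d ℤ.* U)
            lemma = solve-∀

  -- With x = D u², y = E v² and y = x + k: if p ∣ D then E v² ≡ k, if p ∣ E then −D u² ≡ k (mod p),
  -- so E, resp. −D, has the Legendre symbol of k.
  module _ {ps x y k} (classes : SquareClasses ps x y) (y≡k+x : y ≡ k + x) (p∤k : ¬ p ∣ k) where

    open SquareClasses classes

    private
      gap : product (right ps side) * (v * v) ≡ k + product (left ps side) * (u * u)
      gap = trans (sym y≡) (trans y≡k+x (cong (_+_ k) x≡))

    excluded-left : ∀ {s} → p ∈ left ps side → Legendre (+ product (right ps side)) s →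
                    Legendre (+ k) (Sign.opposite s) → ⊥
    excluded-left p∈ = split-at-left u v gap (∈⇒∣product p∈) p∤k

    excluded-right : ∀ {s} → p ∈ right ps side → Legendre (ℤ.- + product (left ps side)) s →
                     Legendre (+ k) (Sign.opposite s) → ⊥
    excluded-right p∈ = split-at-right u v gap (∈⇒∣product p∈) p∤k

-- Quadratic reciprocity

p∤q : ∀ {p q} → Prime p → Prime q → p ≢ q → ¬ p ∣ q
p∤q {p} p-prime q-prime p≢q p∣q with prime⇒irreducible q-prime p∣q
... | inj₁ p≡1 = ¬prime[1] (subst Prime p≡1 p-prime)
... | inj₂ p≡q = p≢q p≡q

module LatticePoints {p q m n : ℕ} (p≡1+2m : p ≡ suc (m + m)) (q≡1+2n : q ≡ suc (n + n))
                     (p-prime : Prime p) (q-prime : Prime q) (p≢q : p ≢ q) where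

  instance
    p≢0 : NonZero p
    p≢0 = prime⇒nonZero p-prime

  p∤kq : ∀ k → 1 ≤ k → k ≤ m → ¬ p ∣ k * q
  p∤kq k 1≤k k≤m p∣kq with euclidsLemma k q p-prime p∣kq
  ... | inj₁ p∣k = ℕ.<⇒≢ 1≤k (sym (m∣n∧n<m⇒n≡0 p∣k (ℕ.≤-<-trans k≤m m<p)))
    where m<p : m < p
          m<p = subst (m <_) (sym p≡1+2m) (s≤s (ℕ.m≤m+n m m))
  ... | inj₂ p∣q = p∤q p-prime q-prime p≢q p∣q

  column : ∀ k → 1 ≤ k → k ≤ m → ∑ n (λ j → ⟦ j * p < k * q ⟧) ≡ k * q / p
  column k 1≤k k≤m = ∑-step n L≤n below above
    where
    L : ℕ
    L = k * q / p
    kq<[1+n]p : k * q < suc n * p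
    kq<[1+n]p = begin-strict
      k * q                   ≤⟨ ℕ.*-monoˡ-≤ q k≤m ⟩
      m * q                   ≡⟨ cong (m *_) q≡1+2n ⟩
      m * suc (n + n)         <⟨ ℕ.m<m+n _ (s≤s z≤n) ⟩
      m * suc (n + n) + suc (m + n) ≡⟨ lemma m n ⟩
      suc n * suc (m + m)     ≡⟨ cong (suc n *_) p≡1+2m ⟨
      suc n * p               ∎
      where open ℕ.≤-Reasoning
            lemma : ∀ m n → m * suc (n + n) + suc (m + n) ≡ suc n * suc (m + m)
            lemma = ℕ-solve-∀
    L≤n : L ≤ n
    L≤n = ℕ.≤-pred (m<n*o⇒m/o<n kq<[1+n]p)
    below : ∀ j → 1 ≤ j → j ≤ L → ⟦ j * p < k * q ⟧ ≡ 1
    below j _ j≤L = ⟦<⟧≡1 (ℕ.≤∧≢⇒< (ℕ.≤-trans (ℕ.*-monoˡ-≤ p j≤L) (m/n*n≤m (k * q) p)) jp≢kq)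
      where jp≢kq : j * p ≢ k * q
            jp≢kq jp≡kq = p∤kq k 1≤k k≤m (subst (p ∣_) jp≡kq (n∣m*n j))
    above : ∀ j → L < j → ⟦ j * p < k * q ⟧ ≡ 0
    above j L<j = ⟦<⟧≡0 (ℕ.≤⇒≯ (ℕ.≤-trans (ℕ.<⇒≤ kq<[1+L]p) (ℕ.*-monoˡ-≤ p L<j)))
      where kq<[1+L]p : k * q < suc L * p
            kq<[1+L]p = subst (_< suc L * p) (sym (m≡m%n+[m/n]*n (k * q) p)) (ℕ.+-monoˡ-< (L * p) (m%n<n (k * q) p))

module _ {p q m n : ℕ} (p≡1+2m : p ≡ suc (m + m)) (q≡1+2n : q ≡ suc (n + n))
         (p-prime : Prime p) (q-prime : Prime q) (p≢q : p ≢ q) where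

  private
    instance
      p≢0 : NonZero p
      p≢0 = prime⇒nonZero p-prime
      q≢0 : NonZero q
      q≢0 = prime⇒nonZero q-prime

  -- Both sums together count the lattice points of [1, m] × [1, n], none of which lies on the line q k = p j.
  lattice-count : ∑ m (λ k → k * q / p) + ∑ n (λ j → j * p / q) ≡ m * n
  lattice-count = begin
    ∑ m (λ k → k * q / p) + ∑ n (λ j → j * p / q)
      ≡⟨ cong₂ _+_ (∑-cong m (λ k 1≤k k≤m → sym (P.column k 1≤k k≤m))) (∑-cong n (λ j 1≤j j≤n → sym (Q.column j 1≤j j≤n))) ⟩
    ∑ m (λ k → ∑ n (λ j → ⟦ j * p < k * q ⟧)) + ∑ n (λ j → ∑ m (λ k → ⟦ k * q < j * p ⟧))
      ≡⟨ cong (_+_ (∑ m (λ k → ∑ n (λ j → ⟦ j * p < k * q ⟧)))) (∑-comm m n (λ k j → ⟦ k * q < j * p ⟧)) ⟨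
    ∑ m (λ k → ∑ n (λ j → ⟦ j * p < k * q ⟧)) + ∑ m (λ k → ∑ n (λ j → ⟦ k * q < j * p ⟧))
      ≡⟨ ∑-+ m _ _ ⟨
    ∑ m (λ k → ∑ n (λ j → ⟦ j * p < k * q ⟧) + ∑ n (λ j → ⟦ k * q < j * p ⟧))
      ≡⟨ ∑-cong m (λ k 1≤k k≤m → trans (sym (∑-+ n _ _)) (∑-cong n (λ j _ _ → ⟦<⟧+⟦>⟧≡1 (jp≢kq k j 1≤k k≤m)))) ⟩
    ∑ m (λ _ → ∑ n (λ _ → 1))
      ≡⟨ ∑-cong m (λ _ _ _ → trans (∑-const n 1) (ℕ.*-identityʳ n)) ⟩
    ∑ m (λ _ → n)
      ≡⟨ ∑-const m n ⟩
    m * n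
      ∎
    where
    open ≡-Reasoning
    module P = LatticePoints {m = m} {n} p≡1+2m q≡1+2n p-prime q-prime p≢q
    module Q = LatticePoints {m = n} {m} q≡1+2n p≡1+2m q-prime p-prime (p≢q ∘ sym)
    jp≢kq : ∀ k j → 1 ≤ k → k ≤ m → j * p ≢ k * q
    jp≢kq k j 1≤k k≤m jp≡kq = P.p∤kq k 1≤k k≤m (subst (p ∣_) jp≡kq (n∣m*n j))

ι-complement : ∀ s x → ι s ℤ.* x ≡ -1ℤ → x ≡ ι (Sign.opposite s)
ι-complement Sign.+ x eq = trans (sym (ℤ.*-identityˡ x)) eq
ι-complement Sign.- x eq = ℤ.neg-injective (trans (sym (ℤ.-1*i≡-i x)) eq)

quadratic-reciprocity : ∀ {p h q l s} (p-prime : Prime p) (p≡4h+3 : p ≡ 4 * h + 3)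
                        (q-prime : Prime q) (q≡4l+3 : q ≡ 4 * l + 3) → p ≢ q →
                        QuadraticCharacter.Legendre p-prime p≡4h+3 (+ q) s →
                        QuadraticCharacter.Legendre q-prime q≡4l+3 (+ p) (Sign.opposite s)
quadratic-reciprocity {p} {h} {q} {l} {s} p-prime p≡4h+3 q-prime q≡4l+3 p≢q χp[q] =
  Q.legendre (Q.≈-trans eisensteinQ (Q.≈-reflexive (ι-complement s (-1ℤ ℤ.^ Tq) signs)))
  where
  module P = QuadraticCharacter {h = h} p-prime p≡4h+3
  module Q = QuadraticCharacter {h = l} q-prime q≡4l+3
  module GP = Gauss {m = P.m} P.p≡1+2m p-prime (p∤q p-prime q-prime p≢q)
  module GQ = Gauss {m = Q.m} Q.p≡1+2m q-prime (p∤q q-prime p-prime (p≢q ∘ sym))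
  Tp Tq : ℕ
  Tp = GP.quotientSum
  Tq = GQ.quotientSum
  eisensteinP : P.χ (+ q) P.≈ -1ℤ ℤ.^ Tp
  eisensteinP = GP.eisenstein {Q.m} Q.p≡1+2m
  eisensteinQ : Q.χ (+ p) Q.≈ -1ℤ ℤ.^ Tq
  eisensteinQ = GQ.eisenstein {P.m} P.p≡1+2m
  -1^Tp≡ι[s] : -1ℤ ℤ.^ Tp ≡ ι s
  -1^Tp≡ι[s] = trans -1^Tp≡ι[t] (cong ι (P.Legendre-unique (P.legendre (P.≈-trans eisensteinP (P.≈-reflexive -1^Tp≡ι[t]))) χp[q]))
    where -1^Tp≡ι[t] : -1ℤ ℤ.^ Tp ≡ ι (proj₁ (-1^-sign Tp))
          -1^Tp≡ι[t] = proj₂ (-1^-sign Tp)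
  signs : ι s ℤ.* -1ℤ ℤ.^ Tq ≡ -1ℤ
  signs = begin
    ι s ℤ.* -1ℤ ℤ.^ Tq                        ≡⟨ cong (ℤ._* -1ℤ ℤ.^ Tq) -1^Tp≡ι[s] ⟨
    -1ℤ ℤ.^ Tp ℤ.* -1ℤ ℤ.^ Tq                 ≡⟨ -1^-+ Tp Tq ⟨
    -1ℤ ℤ.^ (Tp + Tq)                         ≡⟨ cong (-1ℤ ℤ.^_) (lattice-count {m = P.m} {Q.m} P.p≡1+2m Q.p≡1+2m p-prime q-prime p≢q) ⟩
    -1ℤ ℤ.^ (P.m * Q.m)                       ≡⟨ cong (-1ℤ ℤ.^_) (lemma h l) ⟩
    -1ℤ ℤ.^ suc (hl + hl)                     ≡⟨ -1^[1+n+n]≡-1 hl ⟩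
    -1ℤ                                       ∎
    where
    open ≡-Reasoning
    hl : ℕ
    hl = h + l + 2 * h * l
    lemma : ∀ h l → suc (h + h) * suc (l + l) ≡ suc ((h + l + 2 * h * l) + (h + l + 2 * h * l))
    lemma = ℕ-solve-∀

-- Square roots of units

pos-term : ∀ d u → + (d * (u * u)) ≡ + d ℤ.* (+ u ℤ.* + u)
pos-term d u = trans (ℤ.pos-* d (u * u)) (cong (+ d ℤ.*_) (ℤ.pos-* u u))

pos-+-term : ∀ k d u → + (k + d * (u * u)) ≡ + k ℤ.+ + d ℤ.* (+ u ℤ.* + u)
pos-+-term k d u = trans (ℤ.pos-+ k (d * (u * u))) (cong (ℤ._+_ (+ k)) (pos-term d u))

-- (u √d + v √e)² = k ε for ε = a + b √(d e): the fields are the rational part, the irrational part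
-- and the norm d u² − e v² = −k of this identity.
record UnitSquareRoot (k d e a b : ℕ) : Set where
  constructor unit-square-root
  field
    u v             : ℕ
    1≤u             : 1 ≤ u
    1≤v             : 1 ≤ v
    rational-part   : k * a ≡ d * (u * u) + e * (v * v)
    irrational-part : k * b ≡ 2 * (u * v)
    norm            : k + d * (u * u) ≡ e * (v * v)

square-classes⇒root : ∀ {k d e a b x y u v w} → 1 ≤ x → x ≡ d * (u * u) → y ≡ e * (v * v) →
                      y ≡ k + x → k * a ≡ x + y → k * b ≡ 2 * w → x * y ≡ d * e * (w * w) →
                      UnitSquareRoot k d e a b
square-classes⇒root {k} {d} {e} {a} {b} {x} {y} {u} {v} {w} 1≤x x≡du² y≡ev² y≡k+x ka≡x+y kb≡2w xy≡dew² =
  unit-square-root u v (1≤c*z²⇒1≤z {c = d} x≡du² 1≤x) (1≤c*z²⇒1≤z {c = e} y≡ev² 1≤y)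
    (trans ka≡x+y (cong₂ _+_ x≡du² y≡ev²)) (trans kb≡2w (cong (2 *_) w≡uv))
    (trans (cong (_+_ k) (sym x≡du²)) (trans (sym y≡k+x) y≡ev²))
  where
  1≤y : 1 ≤ y
  1≤y = subst (1 ≤_) (sym y≡k+x) (ℕ.≤-trans 1≤x (ℕ.m≤n+m x k))
  instance
    de≢0 : NonZero (d * e)
    de≢0 = ℕ.≢-nonZero λ de≡0 → ℕ.<⇒≢ (ℕ.*-mono-≤ 1≤x 1≤y) (sym (trans xy≡dew² (cong (_* (w * w)) de≡0)))
  w≡uv : w ≡ u * v
  w≡uv = square-injective (ℕ.*-cancelˡ-≡ _ _ (d * e) (begin
    d * e * (w * w)                ≡⟨ xy≡dew² ⟨
    x * y                          ≡⟨ cong₂ _*_ x≡du² y≡ev² ⟩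
    d * (u * u) * (e * (v * v))    ≡⟨ lemma d e u v ⟩
    d * e * (u * v * (u * v))      ∎))
    where open ≡-Reasoning
          lemma : ∀ d e u v → d * (u * u) * (e * (v * v)) ≡ d * e * (u * v * (u * v))
          lemma = ℕ-solve-∀

module _ {k d e a b : ℕ} (root : UnitSquareRoot k d e a b) where

  open UnitSquareRoot root

  root-predecessor : k * (a ∸ 1) ≡ 2 * (d * (u * u))
  root-predecessor = begin
    k * (a ∸ 1)                          ≡⟨ ℕ.*-distribˡ-∸ k a 1 ⟩
    k * a ∸ k * 1                        ≡⟨ cong₂ _∸_ rational-part (ℕ.*-identityʳ k) ⟩
    d * (u * u) + e * (v * v) ∸ k        ≡⟨ cong (λ n → d * (u * u) + n ∸ k) norm ⟨
    d * (u * u) + (k + d * (u * u)) ∸ k  ≡⟨ cong (_∸ k) (lemma k (d * (u * u))) ⟩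
    k + 2 * (d * (u * u)) ∸ k            ≡⟨ ℕ.m+n∸m≡n k _ ⟩
    2 * (d * (u * u))                    ∎
    where open ≡-Reasoning
          lemma : ∀ k D → D + (k + D) ≡ k + 2 * D
          lemma = ℕ-solve-∀

  root-norm-ℤ : + k ≡ ℤ.- (+ d ℤ.* (+ u ℤ.* + u)) ℤ.+ + e ℤ.* (+ v ℤ.* + v)
  root-norm-ℤ = begin
    + k                                                           ≡⟨ lemma (+ k) (+ d ℤ.* (+ u ℤ.* + u)) ⟩
    ℤ.- (+ d ℤ.* (+ u ℤ.* + u)) ℤ.+ (+ k ℤ.+ + d ℤ.* (+ u ℤ.* + u)) ≡⟨ cong (ℤ._+_ (ℤ.- (+ d ℤ.* (+ u ℤ.* + u)))) (trans (sym (pos-+-term k d u)) (trans (cong +_ norm) (pos-term e v))) ⟩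
    ℤ.- (+ d ℤ.* (+ u ℤ.* + u)) ℤ.+ + e ℤ.* (+ v ℤ.* + v)         ∎
    where open ≡-Reasoning
          lemma : ∀ k x → k ≡ ℤ.- x ℤ.+ (k ℤ.+ x)
          lemma = solve-∀

  root-rational-ℤ : + (k * a) ≡ + d ℤ.* (+ u ℤ.* + u) ℤ.+ + e ℤ.* (+ v ℤ.* + v)
  root-rational-ℤ = trans (cong +_ rational-part) (trans (ℤ.pos-+ (d * (u * u)) _) (cong₂ ℤ._+_ (pos-term d u) (pos-term e v)))

root₂-predecessor : ∀ {d e a b} (root : UnitSquareRoot 2 d e a b) →
                    let open UnitSquareRoot root in a ∸ 1 ≡ d * (u * u)
root₂-predecessor root = ℕ.*-cancelˡ-≡ _ _ 2 (root-predecessor root)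

root₁⇒integral : ∀ {d e a b} → UnitSquareRoot 1 d e a b →
  ∃₂ λ (b₁ b₂ : ℤ) → 0ℤ ℤ.< b₁ × 0ℤ ℤ.< b₂
    × + a ≡ (+ d ℤ.* (b₁ ℤ.* b₁)) ℤ.+ (+ e ℤ.* (b₂ ℤ.* b₂))
    × + b ≡ + 2 ℤ.* b₁ ℤ.* b₂
    × + 1 ≡ (ℤ.- (+ d ℤ.* (b₁ ℤ.* b₁))) ℤ.+ (+ e ℤ.* (b₂ ℤ.* b₂))
root₁⇒integral {a = a} {b} root@(unit-square-root u v 1≤u 1≤v _ irrational-part _) =
  + u , + v , ℤ.+<+ 1≤u , ℤ.+<+ 1≤v
  , trans (cong +_ (sym (ℕ.*-identityˡ a))) (root-rational-ℤ root)
  , trans (cong +_ (trans (sym (ℕ.*-identityˡ b)) irrational-part)) (trans (ℤ.pos-* 2 (u * v)) (trans (cong (+ 2 ℤ.*_) (ℤ.pos-* u v)) (sym (ℤ.*-assoc (+ 2) (+ u) (+ v)))))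
  , root-norm-ℤ root

root₂⇒integral : ∀ {d e a b} → UnitSquareRoot 2 d e a b →
  ∃₂ λ (b₁ b₂ : ℤ) → 0ℤ ℤ.< b₁ × 0ℤ ℤ.< b₂
    × + (2 * a) ≡ (+ d ℤ.* (b₁ ℤ.* b₁)) ℤ.+ (+ e ℤ.* (b₂ ℤ.* b₂))
    × + b ≡ b₁ ℤ.* b₂
    × + 2 ≡ (ℤ.- (+ d ℤ.* (b₁ ℤ.* b₁))) ℤ.+ (+ e ℤ.* (b₂ ℤ.* b₂))
root₂⇒integral {b = b} root@(unit-square-root u v 1≤u 1≤v _ irrational-part _) =
  + u , + v , ℤ.+<+ 1≤u , ℤ.+<+ 1≤v , root-rational-ℤ root
  , trans (cong +_ (ℕ.*-cancelˡ-≡ b (u * v) 2 irrational-part)) (ℤ.pos-* u v)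
  , root-norm-ℤ root

no-smaller-unit : ∀ {d a b c u v} → IsFundamentalUnit d a b → a ≡ suc (c + c) → 1 ≤ c →
                  c ≡ d * (u * u) → suc c ≡ v * v → ⊥
no-smaller-unit {d} {a} {b} {c} {u} {v} (_ , _ , _ , minimal) refl 1≤c c≡du² 1+c≡v² =
  ℕ.<⇒≱ v<a (minimal v u 1≤v 1≤u (inj₁ (trans (sym 1+c≡v²) (trans (ℕ.+-comm 1 c) (cong (_+ 1) c≡du²)))))
  where
  1≤u : 1 ≤ u
  1≤u = 1≤c*z²⇒1≤z {c = d} c≡du² 1≤c
  1≤v : 1 ≤ v
  1≤v = 1≤c*z²⇒1≤z {c = 1} (trans 1+c≡v² (sym (ℕ.*-identityˡ (v * v)))) (s≤s z≤n)
  v<a : v < suc (c + c)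
  v<a = ℕ.≤-<-trans (ℕ.m≤m*n v v {{ℕ.>-nonZero 1≤v}}) (subst (_< suc (c + c)) 1+c≡v² (s≤s (ℕ.m<m+n c 1≤c)))

-- The theorem

≡3mod8 : ∀ {n} → n % 8 ≡ 3 → n ≡ 4 * (n / 8 + n / 8) + 3
≡3mod8 {n} n%8≡3 = trans (m≡m%n+[m/n]*n n 8) (trans (cong (_+ n / 8 * 8) n%8≡3) (lemma (n / 8)))
  where lemma : ∀ t → 3 + t * 8 ≡ 4 * (t + t) + 3
        lemma = ℕ-solve-∀

≡7mod8 : ∀ {n} → n % 8 ≡ 7 → n ≡ 4 * suc (n / 8 + n / 8) + 3
≡7mod8 {n} n%8≡7 = trans (m≡m%n+[m/n]*n n 8) (trans (cong (_+ n / 8 * 8) n%8≡7) (lemma (n / 8)))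
  where lemma : ∀ t → 7 + t * 8 ≡ 4 * suc (t + t) + 3
        lemma = ℕ-solve-∀

module FundamentalUnits {q r s : ℕ} (q-prime : Prime q) (r-prime : Prime r) (s-prime : Prime s)
                        (q≢r : q ≢ r) (q≢s : q ≢ s) (r≢s : r ≢ s)
                        (r%8≡3 : r % 8 ≡ 3) (q%8≡3 : q % 8 ≡ 3) (s%8≡7 : s % 8 ≡ 7)
                        ([q/r]≡-1 : LegendreMinusOne q r) ([q/s]≡-1 : LegendreMinusOne q s)
                        ([s/r]≡1 : LegendreOne s r) where

  module Q = QuadraticCharacter {h = q / 8 + q / 8} q-prime (≡3mod8 q%8≡3)
  module R = QuadraticCharacter {h = r / 8 + r / 8} r-prime (≡3mod8 r%8≡3)
  module S = QuadraticCharacter {h = suc (s / 8 + s / 8)} s-prime (≡7mod8 s%8≡7)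

  -- P[x] is the Legendre symbol (x/p) for P ∈ {Q, R, S}.
  R[q] : R.Legendre (+ q) Sign.-
  R[q] = R.nonresidue⇒Legendre- [q/r]≡-1

  R[s] : R.Legendre (+ s) Sign.+
  R[s] = R.residue⇒Legendre+ [s/r]≡1

  R[2] : R.Legendre (+ 2) Sign.-
  R[2] = R.Legendre-2-h-even {r / 8} refl

  S[q] : S.Legendre (+ q) Sign.-
  S[q] = S.nonresidue⇒Legendre- [q/s]≡-1

  S[r] : S.Legendre (+ r) Sign.-
  S[r] = quadratic-reciprocity {h = r / 8 + r / 8} {l = suc (s / 8 + s / 8)} r-prime (≡3mod8 r%8≡3) s-prime (≡7mod8 s%8≡7) r≢s R[s]

  S[2] : S.Legendre (+ 2) Sign.+
  S[2] = S.Legendre-2-h-odd {s / 8} refl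

  Q[r] : Q.Legendre (+ r) Sign.+
  Q[r] = quadratic-reciprocity {h = r / 8 + r / 8} {l = q / 8 + q / 8} r-prime (≡3mod8 r%8≡3) q-prime (≡3mod8 q%8≡3) (q≢r ∘ sym) R[q]

  Q[s] : Q.Legendre (+ s) Sign.+
  Q[s] = quadratic-reciprocity {h = suc (s / 8 + s / 8)} {l = q / 8 + q / 8} s-prime (≡7mod8 s%8≡7) q-prime (≡3mod8 q%8≡3) (q≢s ∘ sym) S[q]

  Q[2] : Q.Legendre (+ 2) Sign.-
  Q[2] = Q.Legendre-2-h-even {q / 8} refl

  2∤q : ¬ 2 ∣ q
  2∤q = 2∤odd {Q.m} ∘ subst (2 ∣_) Q.p≡1+2m
  2∤r : ¬ 2 ∣ r
  2∤r = 2∤odd {R.m} ∘ subst (2 ∣_) R.p≡1+2m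
  2∤s : ¬ 2 ∣ s
  2∤s = 2∤odd {S.m} ∘ subst (2 ∣_) S.p≡1+2m

  2∤* : ∀ {x y} → ¬ 2 ∣ x → ¬ 2 ∣ y → ¬ 2 ∣ x * y
  2∤* {x} {y} 2∤x 2∤y = [ 2∤x , 2∤y ]′ ∘ euclidsLemma x y prime[2]

  2∤qrs : ¬ 2 ∣ q * r * s
  2∤qrs = 2∤* (2∤* 2∤q 2∤r) 2∤s

  norm-≢-1 : ∀ {d x y} → r ∣ d → x * x + 1 ≢ d * (y * y)
  norm-≢-1 {d} {x} {y} r∣d x²+1≡dy² =
    R.split-at-right x y (trans (sym x²+1≡dy²) (trans (ℕ.+-comm (x * x) 1) (cong (_+_ 1) (sym (ℕ.*-identityˡ (x * x))))))
      r∣d R.p∤1 (R.Legendre-neg R.Legendre-1) R.Legendre-1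

  -- In the case analyses, side lists for each prime whether it divides the smaller factor (true).
  module Part₁-odd {a b c b′ : ℕ} (unit : IsFundamentalUnit (q * r * s) a b)
                   (a≡1+2c : a ≡ suc (c + c)) (b≡2b′ : b ≡ 2 * b′) (1≤c : 1 ≤ c)
                   (c[1+c]≡ : c * suc c ≡ q * (r * s) * (b′ * b′)) where

    square-root : SquareClasses (q ∷ r ∷ s ∷ []) c (suc c) → UnitSquareRoot 1 q (r * s) a b
    square-root cl@(square-classes (false ∷ false ∷ false ∷ []) _ _ _ _) = ⊥-elim
      (R.excluded-right cl refl R.p∤1 (there (here refl)) (R.Legendre-neg R.Legendre-1) R.Legendre-1)
    square-root cl@(square-classes (false ∷ false ∷ true ∷ []) _ _ _ _) = ⊥-elim
      (R.excluded-right cl refl R.p∤1 (there (here refl)) (R.Legendre-neg (R[s] R.⊛ R.Legendre-1)) R.Legendre-1)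
    square-root cl@(square-classes (false ∷ true ∷ false ∷ []) _ _ _ _) = ⊥-elim
      (R.excluded-left cl refl R.p∤1 (here refl) (R[q] R.⊛ R[s] R.⊛ R.Legendre-1) R.Legendre-1)
    square-root cl@(square-classes (false ∷ true ∷ true ∷ []) _ _ _ _) = ⊥-elim
      (R.excluded-left cl refl R.p∤1 (here refl) (R[q] R.⊛ R.Legendre-1) R.Legendre-1)
    square-root (square-classes (true ∷ false ∷ false ∷ []) u v c≡ 1+c≡) =
      square-classes⇒root {u = u} {v} {b′} 1≤c (trans c≡ (cong (_* (u * u)) (ℕ.*-identityʳ q)))
        (trans 1+c≡ (cong (λ n → r * n * (v * v)) (ℕ.*-identityʳ s))) refl
        (trans (ℕ.*-identityˡ a) (trans a≡1+2c (sym (ℕ.+-suc c c)))) (trans (ℕ.*-identityˡ b) b≡2b′) c[1+c]≡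
    square-root cl@(square-classes (true ∷ false ∷ true ∷ []) _ _ _ _) = ⊥-elim
      (S.excluded-left cl refl S.p∤1 (there (here refl)) (S[r] S.⊛ S.Legendre-1) S.Legendre-1)
    square-root cl@(square-classes (true ∷ true ∷ false ∷ []) _ _ _ _) = ⊥-elim
      (S.excluded-right cl refl S.p∤1 (here refl) (S.Legendre-neg (S[q] S.⊛ S[r] S.⊛ S.Legendre-1)) S.Legendre-1)
    square-root (square-classes (true ∷ true ∷ true ∷ []) u v c≡ 1+c≡) = ⊥-elim
      (no-smaller-unit {q * r * s} {c = c} {u} {v} unit a≡1+2c 1≤c (trans c≡ (cong (_* (u * u)) (lemma q r s))) (trans 1+c≡ (ℕ.*-identityˡ (v * v))))
      where lemma : ∀ q r s → q * (r * (s * 1)) ≡ q * r * s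
            lemma = ℕ-solve-∀

  module Part₁-even {a b c : ℕ} (a≡2+2c : a ≡ suc (suc (c + c)))
                    (xy≡ : suc (c + c) * suc (suc (suc (c + c))) ≡ q * r * s * (b * b)) where

    2a≡x+y : 2 * a ≡ suc (c + c) + suc (suc (suc (c + c)))
    2a≡x+y = trans (cong (2 *_) a≡2+2c) (lemma c)
      where lemma : ∀ c → 2 * suc (suc (c + c)) ≡ suc (c + c) + suc (suc (suc (c + c)))
            lemma = ℕ-solve-∀

    square-root : SquareClasses (q ∷ r ∷ s ∷ []) (suc (c + c)) (suc (suc (suc (c + c)))) →
           UnitSquareRoot 2 r (q * s) a b ⊎ UnitSquareRoot 2 s (q * r) a b
    square-root cl@(square-classes (false ∷ false ∷ false ∷ []) _ _ _ _) = ⊥-elim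
      (S.excluded-right cl refl S.p∤2 (there (there (here refl))) (S.Legendre-neg S.Legendre-1) S[2])
    square-root (square-classes (false ∷ false ∷ true ∷ []) u v x≡ y≡) = inj₂
      (square-classes⇒root {u = u} {v} {b} (s≤s z≤n) (trans x≡ (cong (_* (u * u)) (ℕ.*-identityʳ s)))
        (trans y≡ (cong (λ n → q * n * (v * v)) (ℕ.*-identityʳ r))) refl 2a≡x+y refl
        (trans xy≡ (cong (_* (b * b)) (lemma q r s))))
      where lemma : ∀ q r s → q * r * s ≡ s * (q * r)
            lemma = ℕ-solve-∀
    square-root (square-classes (false ∷ true ∷ false ∷ []) u v x≡ y≡) = inj₁
      (square-classes⇒root {u = u} {v} {b} (s≤s z≤n) (trans x≡ (cong (_* (u * u)) (ℕ.*-identityʳ r)))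
        (trans y≡ (cong (λ n → q * n * (v * v)) (ℕ.*-identityʳ s))) refl 2a≡x+y refl
        (trans xy≡ (cong (_* (b * b)) (lemma q r s))))
      where lemma : ∀ q r s → q * r * s ≡ r * (q * s)
            lemma = ℕ-solve-∀
    square-root cl@(square-classes (false ∷ true ∷ true ∷ []) _ _ _ _) = ⊥-elim
      (S.excluded-left cl refl S.p∤2 (there (here refl)) (S[q] S.⊛ S.Legendre-1) S[2])
    square-root cl@(square-classes (true ∷ false ∷ false ∷ []) _ _ _ _) = ⊥-elim
      (R.excluded-right cl refl R.p∤2 (here refl) (R.Legendre-neg (R[q] R.⊛ R.Legendre-1)) R[2])
    square-root cl@(square-classes (true ∷ false ∷ true ∷ []) _ _ _ _) = ⊥-elim
      (R.excluded-right cl refl R.p∤2 (here refl) (R.Legendre-neg (R[q] R.⊛ R[s] R.⊛ R.Legendre-1)) R[2])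
    square-root cl@(square-classes (true ∷ true ∷ false ∷ []) _ _ _ _) = ⊥-elim
      (R.excluded-left cl refl R.p∤2 (there (here refl)) (R[s] R.⊛ R.Legendre-1) R[2])
    square-root cl@(square-classes (true ∷ true ∷ true ∷ []) _ _ _ _) = ⊥-elim
      (R.excluded-left cl refl R.p∤2 (there (here refl)) R.Legendre-1 R[2])

  module Part₂ {x y c y′ : ℕ} (unit : IsFundamentalUnit (2 * q * r * s) x y)
               (x≡1+2c : x ≡ suc (c + c)) (y≡2y′ : y ≡ 2 * y′) (1≤c : 1 ≤ c)
               (c[1+c]≡ : c * suc c ≡ 2 * q * r * s * (y′ * y′)) where

    -- c = 2 s u² and c + 1 = q r v² give √(2 ε) = 2 u √s + v √(2 q r).
    doubled-root : ∀ {u v} → c ≡ 2 * (s * 1) * (u * u) → suc c ≡ q * (r * 1) * (v * v) →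
                   UnitSquareRoot 2 s (2 * q * r) x y
    doubled-root {u} {v} c≡ 1+c≡ =
      square-classes⇒root {u = u + u} {v} {y} (ℕ.≤-trans 1≤c (ℕ.m≤m+n c c))
        (trans (cong (λ n → n + n) c≡) (lemma₁ s u)) (trans (cong (λ n → n + n) 1+c≡) (lemma₂ q r (v * v)))
        (lemma₃ c) (trans (cong (2 *_) x≡1+2c) (lemma₄ c)) refl (begin
          (c + c) * (suc c + suc c)              ≡⟨ lemma₅ c ⟩
          4 * (c * suc c)                        ≡⟨ cong (4 *_) c[1+c]≡ ⟩
          4 * (2 * q * r * s * (y′ * y′))        ≡⟨ lemma₆ q r s y′ ⟩
          s * (2 * q * r) * (2 * y′ * (2 * y′))  ≡⟨ cong (λ n → s * (2 * q * r) * (n * n)) y≡2y′ ⟨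
          s * (2 * q * r) * (y * y)              ∎)
      where
      open ≡-Reasoning
      lemma₁ : ∀ s u → 2 * (s * 1) * (u * u) + 2 * (s * 1) * (u * u) ≡ s * ((u + u) * (u + u))
      lemma₁ = ℕ-solve-∀
      lemma₂ : ∀ q r V → q * (r * 1) * V + q * (r * 1) * V ≡ 2 * q * r * V
      lemma₂ = ℕ-solve-∀
      lemma₃ : ∀ c → suc c + suc c ≡ 2 + (c + c)
      lemma₃ = ℕ-solve-∀
      lemma₄ : ∀ c → 2 * suc (c + c) ≡ c + c + (suc c + suc c)
      lemma₄ = ℕ-solve-∀
      lemma₅ : ∀ c → (c + c) * (suc c + suc c) ≡ 4 * (c * suc c)
      lemma₅ = ℕ-solve-∀
      lemma₆ : ∀ q r s y′ → 4 * (2 * q * r * s * (y′ * y′)) ≡ s * (2 * q * r) * (2 * y′ * (2 * y′))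
      lemma₆ = ℕ-solve-∀

    square-root : SquareClasses (2 ∷ q ∷ r ∷ s ∷ []) c (suc c) → UnitSquareRoot 2 s (2 * q * r) x y
    square-root cl@(square-classes (false ∷ false ∷ false ∷ false ∷ []) _ _ _ _) = ⊥-elim
      (R.excluded-right cl refl R.p∤1 (there (there (here refl))) (R.Legendre-neg R.Legendre-1) R.Legendre-1)
    square-root cl@(square-classes (false ∷ false ∷ false ∷ true ∷ []) _ _ _ _) = ⊥-elim
      (R.excluded-right cl refl R.p∤1 (there (there (here refl))) (R.Legendre-neg (R[s] R.⊛ R.Legendre-1)) R.Legendre-1)
    square-root cl@(square-classes (false ∷ false ∷ true ∷ false ∷ []) _ _ _ _) = ⊥-elim
      (Q.excluded-right cl refl Q.p∤1 (there (here refl)) (Q.Legendre-neg (Q[r] Q.⊛ Q.Legendre-1)) Q.Legendre-1)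
    square-root cl@(square-classes (false ∷ false ∷ true ∷ true ∷ []) _ _ _ _) = ⊥-elim
      (Q.excluded-right cl refl Q.p∤1 (there (here refl)) (Q.Legendre-neg (Q[r] Q.⊛ Q[s] Q.⊛ Q.Legendre-1)) Q.Legendre-1)
    square-root cl@(square-classes (false ∷ true ∷ false ∷ false ∷ []) _ _ _ _) = ⊥-elim
      (Q.excluded-left cl refl Q.p∤1 (here refl) (Q[2] Q.⊛ Q[r] Q.⊛ Q[s] Q.⊛ Q.Legendre-1) Q.Legendre-1)
    square-root cl@(square-classes (false ∷ true ∷ false ∷ true ∷ []) _ _ _ _) = ⊥-elim
      (Q.excluded-left cl refl Q.p∤1 (here refl) (Q[2] Q.⊛ Q[r] Q.⊛ Q.Legendre-1) Q.Legendre-1)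
    square-root cl@(square-classes (false ∷ true ∷ true ∷ false ∷ []) _ _ _ _) = ⊥-elim
      (Q.excluded-left cl refl Q.p∤1 (here refl) (Q[2] Q.⊛ Q[s] Q.⊛ Q.Legendre-1) Q.Legendre-1)
    square-root cl@(square-classes (false ∷ true ∷ true ∷ true ∷ []) _ _ _ _) = ⊥-elim
      (Q.excluded-left cl refl Q.p∤1 (here refl) (Q[2] Q.⊛ Q.Legendre-1) Q.Legendre-1)
    square-root cl@(square-classes (true ∷ false ∷ false ∷ false ∷ []) _ _ _ _) = ⊥-elim
      (S.excluded-right cl refl S.p∤1 (there (there (here refl))) (S.Legendre-neg (S[2] S.⊛ S.Legendre-1)) S.Legendre-1)
    square-root (square-classes (true ∷ false ∷ false ∷ true ∷ []) u v c≡ 1+c≡) = doubled-root {u} {v} c≡ 1+c≡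
    square-root cl@(square-classes (true ∷ false ∷ true ∷ false ∷ []) _ _ _ _) = ⊥-elim
      (R.excluded-left cl refl R.p∤1 (there (here refl)) (R[q] R.⊛ R[s] R.⊛ R.Legendre-1) R.Legendre-1)
    square-root cl@(square-classes (true ∷ false ∷ true ∷ true ∷ []) _ _ _ _) = ⊥-elim
      (R.excluded-left cl refl R.p∤1 (there (here refl)) (R[q] R.⊛ R.Legendre-1) R.Legendre-1)
    square-root cl@(square-classes (true ∷ true ∷ false ∷ false ∷ []) _ _ _ _) = ⊥-elim
      (R.excluded-right cl refl R.p∤1 (here refl) (R.Legendre-neg (R[2] R.⊛ R[q] R.⊛ R.Legendre-1)) R.Legendre-1)
    square-root cl@(square-classes (true ∷ true ∷ false ∷ true ∷ []) _ _ _ _) = ⊥-elim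
      (R.excluded-right cl refl R.p∤1 (here refl) (R.Legendre-neg (R[2] R.⊛ R[q] R.⊛ R[s] R.⊛ R.Legendre-1)) R.Legendre-1)
    square-root cl@(square-classes (true ∷ true ∷ true ∷ false ∷ []) _ _ _ _) = ⊥-elim
      (S.excluded-right cl refl S.p∤1 (here refl) (S.Legendre-neg (S[2] S.⊛ S[q] S.⊛ S[r] S.⊛ S.Legendre-1)) S.Legendre-1)
    square-root (square-classes (true ∷ true ∷ true ∷ true ∷ []) u v c≡ 1+c≡) = ⊥-elim
      (no-smaller-unit {2 * q * r * s} {c = c} {u} {v} unit x≡1+2c 1≤c (trans c≡ (cong (_* (u * u)) (lemma q r s))) (trans 1+c≡ (ℕ.*-identityˡ (v * v))))
      where lemma : ∀ q r s → 2 * (q * (r * (s * 1))) ≡ 2 * q * r * s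
            lemma = ℕ-solve-∀

  1≤qrs : 1 ≤ q * r * s
  1≤qrs = ℕ.*-mono-≤ (ℕ.*-mono-≤ (1≤prime q-prime) (1≤prime r-prime)) (1≤prime s-prime)
    where 1≤prime : ∀ {p} → Prime p → 1 ≤ p
          1≤prime {p} p-prime = ℕ.>-nonZero⁻¹ p {{prime⇒nonZero p-prime}}

  primes : All Prime (q ∷ r ∷ s ∷ [])
  primes = q-prime ∷ r-prime ∷ s-prime ∷ []

  part₁-odd : ∀ {a b c} → IsFundamentalUnit (q * r * s) a b → a * a ≡ q * r * s * (b * b) + 1 →
              a ≡ suc (c + c) → UnitSquareRoot 1 q (r * s) a b
  part₁-odd {a} {b} {c} unit@(_ , 1≤b , _) a²≡ a≡1+2c =
    Part₁-odd.square-root {a} {b} {c} {b′} unit a≡1+2c b≡2b′ 1≤c c[1+c]≡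
      (split-squares (q ∷ r ∷ s ∷ []) {z = b′} primes (coprime-suc c) (trans c[1+c]≡ (cong (_* (b′ * b′)) (lemma₁ q r s))))
    where
    lemma₁ : ∀ q r s → q * (r * s) ≡ q * (r * (s * 1))
    lemma₁ = ℕ-solve-∀
    4c[1+c]≡ : 4 * (c * suc c) ≡ q * r * s * (b * b)
    4c[1+c]≡ = ℕ.+-cancelʳ-≡ 1 _ _ (trans (lemma₂ c) (trans (cong (λ n → n * n) (sym a≡1+2c)) a²≡))
      where lemma₂ : ∀ c → 4 * (c * suc c) + 1 ≡ suc (c + c) * suc (c + c)
            lemma₂ = ℕ-solve-∀
    b-even : ∃ λ b′ → b ≡ 2 * b′
    b-even = half-of-square-factor {b = b} 2∤qrs (divides (2 * (c * suc c)) (trans (sym 4c[1+c]≡) (lemma₃ (c * suc c))))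
      where lemma₃ : ∀ n → 4 * n ≡ 2 * n * 2
            lemma₃ = ℕ-solve-∀
    b′ : ℕ
    b′ = proj₁ b-even
    b≡2b′ : b ≡ 2 * b′
    b≡2b′ = proj₂ b-even
    c[1+c]≡ : c * suc c ≡ q * (r * s) * (b′ * b′)
    c[1+c]≡ = ℕ.*-cancelˡ-≡ _ _ 4 (trans 4c[1+c]≡ (trans (cong (λ n → q * r * s * (n * n)) b≡2b′) (lemma₄ q r s b′)))
      where lemma₄ : ∀ q r s b′ → q * r * s * (2 * b′ * (2 * b′)) ≡ 4 * (q * (r * s) * (b′ * b′))
            lemma₄ = ℕ-solve-∀
    1≤c : 1 ≤ c
    1≤c = ℕ.n≢0⇒n>0 λ c≡0 → ℕ.<⇒≢ (ℕ.*-mono-≤ 1≤qrs (ℕ.*-mono-≤ 1≤b 1≤b))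
                                  (trans (sym (cong (λ n → 4 * (n * suc n)) c≡0)) 4c[1+c]≡)

  part₁-even : ∀ {a b c} → 1 ≤ a → a * a ≡ q * r * s * (b * b) + 1 → a ≡ c + c →
               UnitSquareRoot 2 r (q * s) a b ⊎ UnitSquareRoot 2 s (q * r) a b
  part₁-even {c = zero}           1≤a _   refl = ⊥-elim (ℕ.1+n≰n 1≤a)
  part₁-even {a} {b} {suc c} _ a²≡ a≡2+2c =
    Part₁-even.square-root {a} {b} {c} a≡2+2c′ xy≡ (split-squares (q ∷ r ∷ s ∷ []) {z = b} primes (coprime-odd-+2 c) (trans xy≡ (cong (_* (b * b)) (lemma₁ q r s))))
    where
    lemma₁ : ∀ q r s → q * r * s ≡ q * (r * (s * 1))
    lemma₁ = ℕ-solve-∀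
    a≡2+2c′ : a ≡ suc (suc (c + c))
    a≡2+2c′ = trans a≡2+2c (cong suc (ℕ.+-suc c c))
    xy≡ : suc (c + c) * suc (suc (suc (c + c))) ≡ q * r * s * (b * b)
    xy≡ = ℕ.+-cancelʳ-≡ 1 _ _ (trans (lemma₂ c) (trans (cong (λ n → n * n) (sym a≡2+2c′)) a²≡))
      where lemma₂ : ∀ c → suc (c + c) * suc (suc (suc (c + c))) + 1 ≡ suc (suc (c + c)) * suc (suc (c + c))
            lemma₂ = ℕ-solve-∀

  unit-square-root₁ : ∀ {a b} → IsFundamentalUnit (q * r * s) a b →
                      UnitSquareRoot 1 q (r * s) a b ⊎ UnitSquareRoot 2 r (q * s) a b ⊎ UnitSquareRoot 2 s (q * r) a b
  unit-square-root₁ {a} {b} (_ , _ , inj₂ a²+1≡ , _) = ⊥-elim (norm-≢-1 {q * r * s} {a} {b} (∣m⇒∣m*n s (n∣m*n q)) a²+1≡)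
  unit-square-root₁ {a} unit@(1≤a , _ , inj₁ a²≡ , _) with parity a
  ... | c , inj₁ a≡2c   = inj₂ (part₁-even {c = c} 1≤a a²≡ a≡2c)
  ... | c , inj₂ a≡1+2c = inj₁ (part₁-odd {c = c} unit a²≡ a≡1+2c)

  part₂-odd : ∀ {x y c} → IsFundamentalUnit (2 * q * r * s) x y → x * x ≡ 2 * q * r * s * (y * y) + 1 →
              x ≡ suc (c + c) → UnitSquareRoot 2 s (2 * q * r) x y
  part₂-odd {x} {y} {c} unit@(_ , 1≤y , _) x²≡ x≡1+2c =
    Part₂.square-root {x} {y} {c} {y′} unit x≡1+2c y≡2y′ 1≤c c[1+c]≡
      (split-squares (2 ∷ q ∷ r ∷ s ∷ []) {z = y′} (prime[2] ∷ primes) (coprime-suc c) (trans c[1+c]≡ (cong (_* (y′ * y′)) (lemma₁ q r s))))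
    where
    lemma₁ : ∀ q r s → 2 * q * r * s ≡ 2 * (q * (r * (s * 1)))
    lemma₁ = ℕ-solve-∀
    2c[1+c]≡ : 2 * (c * suc c) ≡ q * r * s * (y * y)
    2c[1+c]≡ = ℕ.*-cancelˡ-≡ _ _ 2 (ℕ.+-cancelʳ-≡ 1 _ _ (trans (lemma₂ c) (trans (cong (λ n → n * n) (sym x≡1+2c)) (trans x²≡ (lemma₃ q r s (y * y))))))
      where lemma₂ : ∀ c → 2 * (2 * (c * suc c)) + 1 ≡ suc (c + c) * suc (c + c)
            lemma₂ = ℕ-solve-∀
            lemma₃ : ∀ q r s Y → 2 * q * r * s * Y + 1 ≡ 2 * (q * r * s * Y) + 1
            lemma₃ = ℕ-solve-∀
    y-even : ∃ λ y′ → y ≡ 2 * y′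
    y-even = half-of-square-factor {b = y} 2∤qrs (divides (c * suc c) (trans (sym 2c[1+c]≡) (ℕ.*-comm 2 (c * suc c))))
    y′ : ℕ
    y′ = proj₁ y-even
    y≡2y′ : y ≡ 2 * y′
    y≡2y′ = proj₂ y-even
    c[1+c]≡ : c * suc c ≡ 2 * q * r * s * (y′ * y′)
    c[1+c]≡ = ℕ.*-cancelˡ-≡ _ _ 2 (trans 2c[1+c]≡ (trans (cong (λ n → q * r * s * (n * n)) y≡2y′) (lemma₄ q r s y′)))
      where lemma₄ : ∀ q r s y′ → q * r * s * (2 * y′ * (2 * y′)) ≡ 2 * (2 * q * r * s * (y′ * y′))
            lemma₄ = ℕ-solve-∀
    1≤c : 1 ≤ c
    1≤c = ℕ.n≢0⇒n>0 λ c≡0 → ℕ.<⇒≢ (ℕ.*-mono-≤ 1≤qrs (ℕ.*-mono-≤ 1≤y 1≤y))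
                                  (trans (sym (cong (λ n → 2 * (n * suc n)) c≡0)) 2c[1+c]≡)

  unit-square-root₂ : ∀ {x y} → IsFundamentalUnit (2 * q * r * s) x y → UnitSquareRoot 2 s (2 * q * r) x y
  unit-square-root₂ {x} {y} (_ , _ , inj₂ x²+1≡ , _) = ⊥-elim (norm-≢-1 {2 * q * r * s} {x} {y} (∣m⇒∣m*n s (n∣m*n (2 * q))) x²+1≡)
  unit-square-root₂ {x} {y} unit@(_ , _ , inj₁ x²≡ , _) with parity x
  ... | c , inj₂ x≡1+2c = part₂-odd {c = c} unit x²≡ x≡1+2c
  ... | c , inj₁ x≡2c   = ⊥-elim (odd≢even (q * r * s * (y * y)) (c * c + c * c) (begin
    suc (q * r * s * (y * y) + q * r * s * (y * y))  ≡⟨ lemma₁ q r s (y * y) ⟩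
    2 * q * r * s * (y * y) + 1                      ≡⟨ x²≡ ⟨
    x * x                                            ≡⟨ cong (λ n → n * n) x≡2c ⟩
    (c + c) * (c + c)                                ≡⟨ lemma₂ c ⟩
    c * c + c * c + (c * c + c * c)                  ∎))
    where
    open ≡-Reasoning
    lemma₁ : ∀ q r s Y → suc (q * r * s * Y + q * r * s * Y) ≡ 2 * q * r * s * Y + 1
    lemma₁ = ℕ-solve-∀
    lemma₂ : ∀ c → (c + c) * (c + c) ≡ c * c + c * c + (c * c + c * c)
    lemma₂ = ℕ-solve-∀

  Conclusion₁ : ℕ → ℕ → Set
  Conclusion₁ a b =
    ExactlyOne (IsSquare (2 * q * (a ∸ 1))) (IsSquare (r * (a ∸ 1))) (IsSquare (s * (a ∸ 1)))
    × (IsSquare (2 * q * (a ∸ 1)) →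
        ∃₂ λ (b₁ b₂ : ℤ) → ℤ.0ℤ ℤ.< b₁ × ℤ.0ℤ ℤ.< b₂
          × + a ≡ (+ q ℤ.* (b₁ ℤ.* b₁)) ℤ.+ (+ (r * s) ℤ.* (b₂ ℤ.* b₂))
          × + b ≡ + 2 ℤ.* b₁ ℤ.* b₂
          × + 1 ≡ (- (+ q ℤ.* (b₁ ℤ.* b₁))) ℤ.+ (+ (r * s) ℤ.* (b₂ ℤ.* b₂)))
    × (IsSquare (r * (a ∸ 1)) →
        ∃₂ λ (b₁ b₂ : ℤ) → ℤ.0ℤ ℤ.< b₁ × ℤ.0ℤ ℤ.< b₂
          × + (2 * a) ≡ (+ r ℤ.* (b₁ ℤ.* b₁)) ℤ.+ (+ (q * s) ℤ.* (b₂ ℤ.* b₂))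
          × + b ≡ b₁ ℤ.* b₂
          × + 2 ≡ (- (+ r ℤ.* (b₁ ℤ.* b₁))) ℤ.+ (+ (q * s) ℤ.* (b₂ ℤ.* b₂)))
    × (IsSquare (s * (a ∸ 1)) →
        ∃₂ λ (b₁ b₂ : ℤ) → ℤ.0ℤ ℤ.< b₁ × ℤ.0ℤ ℤ.< b₂
          × + (2 * a) ≡ (+ s ℤ.* (b₁ ℤ.* b₁)) ℤ.+ (+ (q * r) ℤ.* (b₂ ℤ.* b₂))
          × + b ≡ b₁ ℤ.* b₂
          × + 2 ≡ (- (+ s ℤ.* (b₁ ℤ.* b₁))) ℤ.+ (+ (q * r) ℤ.* (b₂ ℤ.* b₂)))

  conclusion₁ : ∀ {a b} → UnitSquareRoot 1 q (r * s) a b ⊎ UnitSquareRoot 2 r (q * s) a b ⊎ UnitSquareRoot 2 s (q * r) a b →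
                Conclusion₁ a b
  conclusion₁ {a} (inj₁ root) = inj₁ (square , ¬square-r , ¬square-s) , (λ _ → root₁⇒integral root) , ⊥-elim ∘ ¬square-r , ⊥-elim ∘ ¬square-s
    where
    open UnitSquareRoot root
    a∸1≡ : a ∸ 1 ≡ 2 * (q * (u * u))
    a∸1≡ = trans (sym (ℕ.*-identityˡ (a ∸ 1))) (root-predecessor root)
    square : IsSquare (2 * q * (a ∸ 1))
    square = subst IsSquare (trans (lemma₁ q (u * u)) (cong (2 * q *_) (sym a∸1≡))) (square-of (2 * q) u)
      where lemma₁ : ∀ q U → 2 * q * (2 * q * U) ≡ 2 * q * (2 * (q * U))
            lemma₁ = ℕ-solve-∀
    ¬square-r : ¬ IsSquare (r * (a ∸ 1))
    ¬square-r = ¬IsSquare prime[2] (2∤* 2∤q 2∤r) 1≤u (trans (cong (r *_) a∸1≡) (lemma₂ q r (u * u)))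
      where lemma₂ : ∀ q r U → r * (2 * (q * U)) ≡ 2 * (q * r) * U
            lemma₂ = ℕ-solve-∀
    ¬square-s : ¬ IsSquare (s * (a ∸ 1))
    ¬square-s = ¬IsSquare prime[2] (2∤* 2∤q 2∤s) 1≤u (trans (cong (s *_) a∸1≡) (lemma₂ q s (u * u)))
      where lemma₂ : ∀ q s U → s * (2 * (q * U)) ≡ 2 * (q * s) * U
            lemma₂ = ℕ-solve-∀
  conclusion₁ {a} (inj₂ (inj₁ root)) = inj₂ (inj₁ (¬square-2q , square , ¬square-s)) , ⊥-elim ∘ ¬square-2q , (λ _ → root₂⇒integral root) , ⊥-elim ∘ ¬square-s
    where
    open UnitSquareRoot root
    a∸1≡ : a ∸ 1 ≡ r * (u * u)
    a∸1≡ = root₂-predecessor root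
    square : IsSquare (r * (a ∸ 1))
    square = subst IsSquare (cong (r *_) (sym a∸1≡)) (square-of r u)
    ¬square-2q : ¬ IsSquare (2 * q * (a ∸ 1))
    ¬square-2q = ¬IsSquare prime[2] (2∤* 2∤q 2∤r) 1≤u (trans (cong (2 * q *_) a∸1≡) (lemma₁ q r (u * u)))
      where lemma₁ : ∀ q r U → 2 * q * (r * U) ≡ 2 * (q * r) * U
            lemma₁ = ℕ-solve-∀
    ¬square-s : ¬ IsSquare (s * (a ∸ 1))
    ¬square-s = ¬IsSquare r-prime (p∤q r-prime s-prime r≢s) 1≤u (trans (cong (s *_) a∸1≡) (lemma₂ r s (u * u)))
      where lemma₂ : ∀ r s U → s * (r * U) ≡ r * s * U
            lemma₂ = ℕ-solve-∀
  conclusion₁ {a} (inj₂ (inj₂ root)) = inj₂ (inj₂ (¬square-2q , ¬square-r , square)) , ⊥-elim ∘ ¬square-2q , ⊥-elim ∘ ¬square-r , (λ _ → root₂⇒integral root)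
    where
    open UnitSquareRoot root
    a∸1≡ : a ∸ 1 ≡ s * (u * u)
    a∸1≡ = root₂-predecessor root
    square : IsSquare (s * (a ∸ 1))
    square = subst IsSquare (cong (s *_) (sym a∸1≡)) (square-of s u)
    ¬square-2q : ¬ IsSquare (2 * q * (a ∸ 1))
    ¬square-2q = ¬IsSquare prime[2] (2∤* 2∤q 2∤s) 1≤u (trans (cong (2 * q *_) a∸1≡) (lemma₁ q s (u * u)))
      where lemma₁ : ∀ q s U → 2 * q * (s * U) ≡ 2 * (q * s) * U
            lemma₁ = ℕ-solve-∀
    ¬square-r : ¬ IsSquare (r * (a ∸ 1))
    ¬square-r = ¬IsSquare s-prime (p∤q s-prime r-prime (r≢s ∘ sym)) 1≤u (trans (cong (r *_) a∸1≡) (lemma₂ r s (u * u)))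
      where lemma₂ : ∀ r s U → r * (s * U) ≡ s * r * U
            lemma₂ = ℕ-solve-∀

  conclusion₂ : ∀ {x y} → UnitSquareRoot 2 s (2 * q * r) x y →
    IsSquare (s * (x ∸ 1))
    × ∃₂ λ (y₁ y₂ : ℤ) → ℤ.0ℤ ℤ.< y₁ × ℤ.0ℤ ℤ.< y₂
          × + (2 * x) ≡ (+ s ℤ.* (y₁ ℤ.* y₁)) ℤ.+ (+ (2 * q * r) ℤ.* (y₂ ℤ.* y₂))
          × + y ≡ y₁ ℤ.* y₂
          × + 2 ≡ (- (+ s ℤ.* (y₁ ℤ.* y₁))) ℤ.+ (+ (2 * q * r) ℤ.* (y₂ ℤ.* y₂))
  conclusion₂ root = subst IsSquare (cong (s *_) (sym (root₂-predecessor root))) (square-of s (UnitSquareRoot.u root)) , root₂⇒integral root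

mainTheorem6 : (q r s : ℕ) → Prime q → Prime r → Prime s →
  q ≢ r → q ≢ s → r ≢ s →
  r % 8 ≡ 3 → q % 8 ≡ 3 → s % 8 ≡ 7 →
  LegendreMinusOne q r → LegendreMinusOne q s → LegendreOne s r →
  ((a b : ℕ) → IsFundamentalUnit (q * r * s) a b →
    ExactlyOne (IsSquare (2 * q * (a ∸ 1))) (IsSquare (r * (a ∸ 1))) (IsSquare (s * (a ∸ 1)))
    × (IsSquare (2 * q * (a ∸ 1)) →
        ∃₂ λ (b₁ b₂ : ℤ) → ℤ.0ℤ ℤ.< b₁ × ℤ.0ℤ ℤ.< b₂
          × + a ≡ (+ q ℤ.* (b₁ ℤ.* b₁)) ℤ.+ (+ (r * s) ℤ.* (b₂ ℤ.* b₂))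
          × + b ≡ + 2 ℤ.* b₁ ℤ.* b₂
          × + 1 ≡ (- (+ q ℤ.* (b₁ ℤ.* b₁))) ℤ.+ (+ (r * s) ℤ.* (b₂ ℤ.* b₂)))
    × (IsSquare (r * (a ∸ 1)) →
        ∃₂ λ (b₁ b₂ : ℤ) → ℤ.0ℤ ℤ.< b₁ × ℤ.0ℤ ℤ.< b₂
          × + (2 * a) ≡ (+ r ℤ.* (b₁ ℤ.* b₁)) ℤ.+ (+ (q * s) ℤ.* (b₂ ℤ.* b₂))
          × + b ≡ b₁ ℤ.* b₂
          × + 2 ≡ (- (+ r ℤ.* (b₁ ℤ.* b₁))) ℤ.+ (+ (q * s) ℤ.* (b₂ ℤ.* b₂)))
    × (IsSquare (s * (a ∸ 1)) →
        ∃₂ λ (b₁ b₂ : ℤ) → ℤ.0ℤ ℤ.< b₁ × ℤ.0ℤ ℤ.< b₂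
          × + (2 * a) ≡ (+ s ℤ.* (b₁ ℤ.* b₁)) ℤ.+ (+ (q * r) ℤ.* (b₂ ℤ.* b₂))
          × + b ≡ b₁ ℤ.* b₂
          × + 2 ≡ (- (+ s ℤ.* (b₁ ℤ.* b₁))) ℤ.+ (+ (q * r) ℤ.* (b₂ ℤ.* b₂))))
  × ((x y : ℕ) → IsFundamentalUnit (2 * q * r * s) x y →
    IsSquare (s * (x ∸ 1))
    × ∃₂ λ (y₁ y₂ : ℤ) → ℤ.0ℤ ℤ.< y₁ × ℤ.0ℤ ℤ.< y₂
          × + (2 * x) ≡ (+ s ℤ.* (y₁ ℤ.* y₁)) ℤ.+ (+ (2 * q * r) ℤ.* (y₂ ℤ.* y₂))
          × + y ≡ y₁ ℤ.* y₂
          × + 2 ≡ (- (+ s ℤ.* (y₁ ℤ.* y₁))) ℤ.+ (+ (2 * q * r) ℤ.* (y₂ ℤ.* y₂)))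
mainTheorem6 q r s q-prime r-prime s-prime q≢r q≢s r≢s r%8≡3 q%8≡3 s%8≡7 [q/r]≡-1 [q/s]≡-1 [s/r]≡1 =
  (λ _ _ unit → conclusion₁ (unit-square-root₁ unit)) , (λ _ _ unit → conclusion₂ (unit-square-root₂ unit))
  where open FundamentalUnits q-prime r-prime s-prime q≢r q≢s r≢s r%8≡3 q%8≡3 s%8≡7 [q/r]≡-1 [q/s]≡-1 [s/r]≡1
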